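{- Let $q$ be a power of an odd prime with $q\equiv 3 \pmod 4$, and let $d\equiv 3 \pmod 4$ be a positive integer. Let $P\subset \mathbb{F}_q^d$ be a set of points and let $S$ be a set of spheres in $\mathbb{F}_q^d$ all of whose radii are squares in $\mathbb{F}_q$. If $|P|\le N$ and $|S|\le N$, then \[ I(P,S)\ll q^{ -1}N^2+q^{\frac{d-1}{2}}N. \]
   Context: A sphere in $\mathbb{F}_q^d$ with center $c=(c_1,\dots,c_d)\in\mathbb{F}_q^d$ and radius $r\in\mathbb{F}_q$ is the set $\{x\in\mathbb{F}_q^d : (x_1-c_1)^2+\cdots+(x_d-c_d)^2=r\}$; spheres are indexed by the pair (center, radius). A radius $r$ is a square if $r=t^2$ for some $t\in\mathbb{F}_q$. The number of incidences is $I(P,S)=\#\{(p,s)\in P\times S : p\in s\}$. $X\ll Y$ means $X\le C Y$ for an absolute constant $C>0$. -}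

module Defs where

open import Algebra.Apartness.Structures using (IsHeytingField)
open import Algebra.Bundles using (CommutativeRing)
import Algebra.Properties.Semiring.Sum as Sum
open import Data.Fin.Base using (Fin)
open import Data.Fin.Properties using (inj⇒≟)
open import Data.List.Base using (List; length; filter; cartesianProduct)
open import Data.Nat.Base using (ℕ; _^_; _≥_)
open import Data.Nat.Primality using (Prime)
open import Data.Product.Base using (_×_; _,_; proj₂; ∃-syntax; uncurry)
open import Data.Vec.Base using (Vec; lookup)
open import Function.Bundles using (_↔_)
open import Function.Properties.Inverse using (↔⇒↣)
open import Level using (0ℓ)
open import Relation.Binary.Definitions using (DecidableEquality)
open import Relation.Binary.PropositionalEquality using (_≡_; _≢_)
open import Relation.Nullary.Decidable using (Dec)

IsOddPrimePower : ℕ → Set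
IsOddPrimePower q = ∃[ p ] ∃[ k ] (Prime p × p ≢ 2 × k ≥ 1 × q ≡ p ^ k)

-- With _≢_ as the apartness relation, a Heyting field is an ordinary field:
-- x ≢ y exactly when x - y is invertible (in particular 0# ≢ 1#).
record FiniteField (q : ℕ) : Set₁ where
  infixl 7 _*_
  infixl 6 _+_
  infix  8 -_
  field
    Carrier        : Set
    _+_ _*_        : Carrier → Carrier → Carrier
    -_             : Carrier → Carrier
    0# 1#          : Carrier
    isHeytingField : IsHeytingField _≡_ _≢_ _+_ _*_ -_ 0# 1#
    enumeration    : Carrier ↔ Fin q

  open IsHeytingField isHeytingField public using (isCommutativeRing)

  commutativeRing : CommutativeRing 0ℓ 0ℓ
  commutativeRing = record { isCommutativeRing = isCommutativeRing }

  open CommutativeRing commutativeRing public using (_-_; semiring)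

  _≟_ : DecidableEquality Carrier
  _≟_ = inj⇒≟ (↔⇒↣ enumeration)

  IsSquare : Carrier → Set
  IsSquare r = ∃[ t ] r ≡ t * t

module Incidences {q : ℕ} (F : FiniteField q) (d : ℕ) where
  open FiniteField F
  open Sum semiring using (sum)

  Point : Set
  Point = Vec Carrier d

  -- A (center , radius) pair: spheres with different indices are distinct,
  -- even when they have the same points.
  Sphere : Set
  Sphere = Point × Carrier

  radius : Sphere → Carrier
  radius = proj₂

  sqDist : Point → Point → Carrier
  sqDist x c = sum λ i → (lookup x i - lookup c i) * (lookup x i - lookup c i)

  infix 4 _∈ˢ_ _∈ˢ?_

  _∈ˢ_ : Point → Sphere → Set
  x ∈ˢ (c , r) = sqDist x c ≡ r

  _∈ˢ?_ : ∀ x s → Dec (x ∈ˢ s)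
  x ∈ˢ? (c , r) = sqDist x c ≟ r

  -- Finite sets are given as lists; this is the number of incident pairs when
  -- neither list has repetitions.
  I : List Point → List Sphere → ℕ
  I P S = length (filter (uncurry _∈ˢ?_) (cartesianProduct P S))

{-# OPTIONS --safe #-}

-- A point x lies on the sphere with centre c and radius t² exactly when (0,x) - (t,c) is isotropic
-- for Q = -t² + x₁² + ⋯ + x_d² on F_q^n, n = d + 1.  As q ≡ 3 and n ≡ 0 (mod 4), Q is elliptic: the
-- fibres of Q over nonzero values all have the same size, and the fibre over 0 is smaller by q^(n/2).
-- Hence for z ≠ 0 the number of isotropic m with ⟨m,z⟩ = 0 is q^(n-2), less (q-1)q^(n/2-1) when z
-- is isotropic.  For a family E of vectors, Cauchy-Schwarz applied to the distribution of
-- ⟨m,x⟩, x ∈ E, and summed over the isotropic m, bounds a sum over pairs x, y ∈ E in which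
-- isotropic differences x - y enter with a negative sign.  This gives
--   #{(x,y) ∈ E² : Q(x - y) = 0} ≤ |E|²/q + q^(n/2-1) #{(x,y) ∈ E² : x = y},
-- and E is taken to consist of the lifted points together with the lifted spheres.
module Submission where

open import Defs
open import Data.Nat.Base as ℕ using (ℕ; NonZero; _∸_; _^_; _%_)
open import Relation.Binary.PropositionalEquality using (_≡_)

-- Both congruences serve to fix one sign. `Q` is the sum of the hyperbolic plane x₁² - t² and of
-- (d-1)/2 planes x² + y². As q ≡ 3 (mod 4), -1 is not a square, so each plane x² + y² is
-- anisotropic and multiplies the deviation from uniform fibres by -q, while the hyperbolic plane
-- multiplies it by q. For d ≡ 3 (mod 4) the number (d-1)/2 is odd and the minus sign survives.
-- Cauchy-Schwarz only bounds second moments from below, so this sign decides everything: with the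
-- opposite one the same computation would bound the isotropic pairs from below. The count over E²
-- contains more than the incidences, but the surplus is nonnegative, and merging points and spheres
-- into one family lets a single symmetric inequality do the work. All counts are integers and no
-- characters occur; divisions by q are avoided by keeping factors q on both sides until the end.

-- Integer sums over lists, indicator functions and the Cauchy-Schwarz inequality.

module ListSums where

  open import Data.Integer.Base hiding (suc)
  open import Data.Integer.Properties
  open import Data.Integer.Tactic.RingSolver using (solve-∀)
  open import Data.List.Base
    using (List; []; _∷_; _++_; map; foldr; length; filter; cartesianProductWith)
  open import Data.List.Properties using (map-∘)
  open import Data.List.Membership.Propositional using (_∈_; _∉_)
  open import Data.List.Membership.Propositional.Properties using (∈-map⁺; ∈-map⁻)
  open import Data.List.Membership.Propositional.Properties.WithK using (unique∧set⇒bag)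
  open import Data.List.Relation.Binary.BagAndSetEquality using (∼bag⇒↭)
  open import Data.List.Relation.Binary.Permutation.Propositional using (_↭_; ↭⇒↭ₛ)
  import Data.List.Relation.Binary.Permutation.Setoid.Properties as ↭ₛ
  open import Data.List.Relation.Unary.All as All using (All; []; _∷_)
  open import Data.List.Relation.Unary.Any using (here; there)
  open import Data.List.Relation.Unary.AllPairs using ([]; _∷_)
  open import Data.List.Relation.Unary.Unique.Propositional using (Unique)
  import Data.List.Relation.Unary.Unique.Propositional.Properties as Unique
  open import Data.Nat.Base using (zero; suc)
  open import Data.Product.Base using (_×_; _,_)
  open import Function.Base using (_∘_; case_of_)
  open import Function.Bundles using (mk⇔)
  open import Relation.Binary.Definitions using (DecidableEquality)
  open import Relation.Binary.PropositionalEquality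
  open import Relation.Nullary.Decidable using (Dec; yes; no; _×-dec_)
  open import Relation.Nullary.Negation using (¬_; contradiction)

  private variable
    A B D P Q : Set

  δ : Dec P → ℤ
  δ (yes _) = 1ℤ
  δ (no  _) = 0ℤ

  δ-yes : (p : Dec P) → P → δ p ≡ 1ℤ
  δ-yes (yes _)  _ = refl
  δ-yes (no ¬p)  p = contradiction p ¬p

  δ-no : (p : Dec P) → ¬ P → δ p ≡ 0ℤ
  δ-no (yes p) ¬p = contradiction p ¬p
  δ-no (no  _)  _ = refl

  δ-cong : (p : Dec P) (q : Dec Q) → (P → Q) → (Q → P) → δ p ≡ δ q
  δ-cong (yes p) q to from = sym (δ-yes q (to p))
  δ-cong (no ¬p) q to from = sym (δ-no q (¬p ∘ from))

  δ-× : (p : Dec P) (q : Dec Q) → δ (p ×-dec q) ≡ δ p * δ q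
  δ-× (yes _) (yes _) = refl
  δ-× (yes _) (no  _) = refl
  δ-× (no  _) _       = refl

  δ-nonNeg : (p : Dec P) → 0ℤ ≤ δ p
  δ-nonNeg (yes _) = +≤+ ℕ.z≤n
  δ-nonNeg (no  _) = ≤-refl

  δ-mono : (p : Dec P) (q : Dec Q) → (P → Q) → δ p ≤ δ q
  δ-mono (yes p) q to = ≤-reflexive (sym (δ-yes q (to p)))
  δ-mono (no  _) q _  = δ-nonNeg q

  ∑ : List A → (A → ℤ) → ℤ
  ∑ xs f = foldr _+_ 0ℤ (map f xs)

  infix 5 ∑
  syntax ∑ xs (λ x → e) = ∑[ x ← xs ] e

  ∑-cong : (xs : List A) {f g : A → ℤ} → (∀ x → f x ≡ g x) → ∑ xs f ≡ ∑ xs g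
  ∑-cong []       _ = refl
  ∑-cong (x ∷ xs) h = cong₂ _+_ (h x) (∑-cong xs h)

  ∑-mono : (xs : List A) {f g : A → ℤ} → (∀ x → f x ≤ g x) → ∑ xs f ≤ ∑ xs g
  ∑-mono []       _ = ≤-refl
  ∑-mono (x ∷ xs) h = +-mono-≤ (h x) (∑-mono xs h)

  ∑-const : (xs : List A) (c : ℤ) → ∑[ _ ← xs ] c ≡ + length xs * c
  ∑-const []       c = refl
  ∑-const (x ∷ xs) c = trans (cong (λ s → c + s) (∑-const xs c)) (sym (suc-* (+ length xs) c))

  ∑-0 : (xs : List A) → ∑[ _ ← xs ] 0ℤ ≡ 0ℤ
  ∑-0 xs = trans (∑-const xs 0ℤ) (*-zeroʳ (+ length xs))

  ∑-+ : (xs : List A) (f g : A → ℤ) → ∑[ x ← xs ] (f x + g x) ≡ ∑ xs f + ∑ xs g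
  ∑-+ []       f g = refl
  ∑-+ (x ∷ xs) f g rewrite ∑-+ xs f g = eq (f x) (g x) (∑ xs f) (∑ xs g)
    where
    eq : ∀ a b c d → a + b + (c + d) ≡ a + c + (b + d)
    eq = solve-∀

  ∑-*ˡ : (xs : List A) (c : ℤ) (f : A → ℤ) → ∑[ x ← xs ] c * f x ≡ c * ∑ xs f
  ∑-*ˡ []       c f = sym (*-zeroʳ c)
  ∑-*ˡ (x ∷ xs) c f = trans (cong (λ s → c * f x + s) (∑-*ˡ xs c f))
                            (sym (*-distribˡ-+ c (f x) (∑ xs f)))

  ∑-*ʳ : (xs : List A) (f : A → ℤ) (c : ℤ) → ∑[ x ← xs ] f x * c ≡ ∑ xs f * c
  ∑-*ʳ xs f c = trans (∑-cong xs (λ x → *-comm (f x) c))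
                      (trans (∑-*ˡ xs c f) (*-comm c (∑ xs f)))

  ∑-affine : (xs : List A) (a b : ℤ) (f : A → ℤ) →
             ∑[ x ← xs ] (a + b * f x) ≡ + length xs * a + b * ∑ xs f
  ∑-affine xs a b f = trans (∑-+ xs (λ _ → a) (λ x → b * f x))
                            (cong₂ _+_ (∑-const xs a) (∑-*ˡ xs b f))

  ∑-swap : (xs : List A) (ys : List B) (f : A → B → ℤ) →
           ∑[ x ← xs ] ∑[ y ← ys ] f x y ≡ ∑[ y ← ys ] ∑[ x ← xs ] f x y
  ∑-swap []       ys f = sym (∑-0 ys)
  ∑-swap (x ∷ xs) ys f = trans (cong (λ s → ∑ ys (f x) + s) (∑-swap xs ys f))
                               (sym (∑-+ ys (f x) (λ y → ∑[ x ← xs ] f x y)))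

  ∑-++ : (xs ys : List A) (f : A → ℤ) → ∑ (xs ++ ys) f ≡ ∑ xs f + ∑ ys f
  ∑-++ []       ys f = sym (+-identityˡ _)
  ∑-++ (x ∷ xs) ys f = trans (cong (λ s → f x + s) (∑-++ xs ys f)) (sym (+-assoc (f x) _ _))

  ∑-map : (g : A → B) (xs : List A) (f : B → ℤ) → ∑ (map g xs) f ≡ ∑[ x ← xs ] f (g x)
  ∑-map g xs f = cong (foldr _+_ 0ℤ) (sym (map-∘ xs))

  ∑-cartesianProductWith : (g : A → B → D) (xs : List A) (ys : List B) (f : D → ℤ) →
    ∑ (cartesianProductWith g xs ys) f ≡ ∑[ x ← xs ] ∑[ y ← ys ] f (g x y)
  ∑-cartesianProductWith g []       ys f = refl
  ∑-cartesianProductWith g (x ∷ xs) ys f =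
    trans (∑-++ (map (g x) ys) _ f)
          (cong₂ _+_ (∑-map (g x) ys f) (∑-cartesianProductWith g xs ys f))

  ∑-product : (xs : List A) (ys : List B) (f : A → ℤ) (g : B → ℤ) →
              ∑[ x ← xs ] ∑[ y ← ys ] f x * g y ≡ ∑ xs f * ∑ ys g
  ∑-product xs ys f g = trans (∑-cong xs (λ x → ∑-*ˡ ys (f x) g)) (∑-*ʳ xs f (∑ ys g))

  ∑-δ≡length-filter : {R : A → Set} (R? : ∀ x → Dec (R x)) (xs : List A) →
                      + length (filter R? xs) ≡ ∑[ x ← xs ] δ (R? x)
  ∑-δ≡length-filter R? []       = refl
  ∑-δ≡length-filter R? (x ∷ xs) with R? x
  ... | yes _ = cong (λ s → 1ℤ + s) (∑-δ≡length-filter R? xs)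
  ... | no  _ = trans (∑-δ≡length-filter R? xs) (sym (+-identityˡ _))

  ∑-nonNeg : (xs : List A) {f : A → ℤ} → (∀ x → 0ℤ ≤ f x) → 0ℤ ≤ ∑ xs f
  ∑-nonNeg xs {f} h = subst (λ s → s ≤ ∑ xs f) (∑-0 xs) (∑-mono xs h)

  ∑-++-≥ˡ : (xs ys : List A) {f : A → ℤ} → (∀ x → 0ℤ ≤ f x) → ∑ xs f ≤ ∑ (xs ++ ys) f
  ∑-++-≥ˡ xs ys {f} h = subst₂ _≤_ (+-identityʳ _) (sym (∑-++ xs ys f))
                                   (+-monoʳ-≤ (∑ xs f) (∑-nonNeg ys h))

  ∑-++-≥ʳ : (xs ys : List A) {f : A → ℤ} → (∀ x → 0ℤ ≤ f x) → ∑ ys f ≤ ∑ (xs ++ ys) f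
  ∑-++-≥ʳ xs ys {f} h = subst₂ _≤_ (+-identityˡ _) (sym (∑-++ xs ys f))
                                   (+-monoˡ-≤ (∑ ys f) (∑-nonNeg xs h))

  -- Used to turn a vanishing total of squares into a pointwise identity, in `roots-±≡2`.
  ∑-nonNeg-≡0 : (xs : List A) {f : A → ℤ} → (∀ x → 0ℤ ≤ f x) → ∑ xs f ≡ 0ℤ →
                ∀ {x} → x ∈ xs → f x ≡ 0ℤ
  ∑-nonNeg-≡0 (x ∷ xs) {f} h ∑≡0 y∈ = case y∈ of λ where
      (here refl) → fx≡0
      (there y∈)  → ∑-nonNeg-≡0 xs h S≡0 y∈
    where
    S = ∑ xs f
    fx≡0 : f x ≡ 0ℤ
    fx≡0 = ≤-antisym (subst (f x ≤_) ∑≡0 (subst (λ z → z ≤ f x + S) (+-identityʳ (f x))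
                       (+-monoʳ-≤ (f x) (∑-nonNeg xs h)))) (h x)
    S≡0 : S ≡ 0ℤ
    S≡0 = trans (sym (+-identityˡ S)) (trans (cong (λ z → z + S) (sym fx≡0)) ∑≡0)

  square-nonNeg : ∀ i → 0ℤ ≤ i * i
  square-nonNeg (+ zero)  = ≤-refl
  square-nonNeg +[1+ n ]  = +≤+ ℕ.z≤n
  square-nonNeg -[1+ n ]  = +≤+ ℕ.z≤n

  -- By induction on the list: prepending an entry with value a increases the difference of the two
  -- sides by the sum of the squares (a - f y)² over the remaining y.
  cauchySchwarz : (xs : List A) (f : A → ℤ) →
                  ∑ xs f * ∑ xs f ≤ + length xs * (∑[ x ← xs ] f x * f x)
  cauchySchwarz []       f = ≤-refl
  cauchySchwarz (x ∷ xs) f = 0≤i-j⇒j≤i (subst (0ℤ ≤_) expand (+-mono-≤ cs deviations))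
    where
    a = f x
    n = + length xs
    S = ∑ xs f
    T = ∑[ y ← xs ] f y * f y
    cs : 0ℤ ≤ n * T - S * S
    cs = i≤j⇒0≤j-i (cauchySchwarz xs f)
    deviation : ∀ u v → (u * u + (- (u + u)) * v) + v * v ≡ (u - v) * (u - v)
    deviation = solve-∀
    deviations : 0ℤ ≤ (n * (a * a) + (- (a + a)) * S) + T
    deviations = subst (0ℤ ≤_)
      (trans (∑-cong xs (λ y → sym (deviation a (f y))))
      (trans (∑-+ xs _ _) (cong (λ s → s + T) (∑-affine xs (a * a) (- (a + a)) f))))
      (∑-nonNeg xs (λ y → square-nonNeg (a - f y)))
    alg : ∀ a n S T → (n * T - S * S) + ((n * (a * a) + (- (a + a)) * S) + T) ≡
                      (1ℤ + n) * (a * a + T) - (a + S) * (a + S)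
    alg = solve-∀
    expand : (n * T - S * S) + ((n * (a * a) + (- (a + a)) * S) + T) ≡
             + suc (length xs) * (a * a + T) - (a + S) * (a + S)
    expand = alg a n S T

  ∑-δ-∉ : (_≟_ : DecidableEquality A) {a : A} {xs : List A} → a ∉ xs → (f : A → ℤ) →
          ∑[ x ← xs ] δ (x ≟ a) * f x ≡ 0ℤ
  ∑-δ-∉ _≟_ {xs = []}     a∉ f = refl
  ∑-δ-∉ _≟_ {a} {x ∷ xs} a∉ f
    rewrite δ-no (x ≟ a) (a∉ ∘ here ∘ sym) | ∑-δ-∉ _≟_ (a∉ ∘ there) f = refl

  ∑-δ : (_≟_ : DecidableEquality A) {a : A} {xs : List A} → Unique xs → a ∈ xs → (f : A → ℤ) →
        ∑[ x ← xs ] δ (x ≟ a) * f x ≡ f a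
  ∑-δ _≟_ {a} (x∉ ∷ u) (here refl) f
    rewrite δ-yes (a ≟ a) refl
          | ∑-δ-∉ _≟_ (λ a∈ → All.lookup x∉ a∈ refl) f
    = trans (+-identityʳ _) (*-identityˡ (f a))
  ∑-δ _≟_ {a} {x ∷ xs} (x∉ ∷ u) (there a∈) f
    rewrite δ-no (x ≟ a) (All.lookup x∉ a∈) | ∑-δ _≟_ u a∈ f = +-identityˡ (f a)

  ∑-δ-≤1 : (_≟_ : DecidableEquality A) {xs : List A} → Unique xs → ∀ a →
           ∑[ x ← xs ] δ (x ≟ a) ≤ 1ℤ
  ∑-δ-≤1 _≟_ []                     a = +≤+ ℕ.z≤n
  ∑-δ-≤1 _≟_ {x ∷ xs} (x∉ ∷ u) a with x ≟ a
  ... | no  _    = subst (_≤ 1ℤ) (sym (+-identityˡ _)) (∑-δ-≤1 _≟_ u a)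
  ... | yes refl = ≤-reflexive (cong (λ s → 1ℤ + s)
    (trans (∑-cong xs (λ y → sym (*-identityʳ (δ (y ≟ x)))))
           (∑-δ-∉ _≟_ (λ x∈ → All.lookup x∉ x∈ refl) (λ _ → 1ℤ))))

  Enumerates : List A → Set
  Enumerates xs = Unique xs × (∀ x → x ∈ xs)

  unique-↭ : {xs ys : List A} → Unique xs → Unique ys →
    (∀ {x} → x ∈ xs → x ∈ ys) → (∀ {x} → x ∈ ys → x ∈ xs) → xs ↭ ys
  unique-↭ u v to from = ∼bag⇒↭ (unique∧set⇒bag u v (mk⇔ to from))

  map-bijection-↭ : {xs : List A} (φ ψ : A → A) → Unique xs →
    (∀ x → φ (ψ x) ≡ x) → (∀ x → ψ (φ x) ≡ x) →
    (∀ {x} → x ∈ xs → φ x ∈ xs) → (∀ {x} → x ∈ xs → ψ x ∈ xs) →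
    map φ xs ↭ xs
  map-bijection-↭ {xs = xs} φ ψ u φψ ψφ φ∈ ψ∈ =
    unique-↭ (Unique.map⁺ injective u) u to from
    where
    injective : ∀ {x y} → φ x ≡ φ y → x ≡ y
    injective {x} {y} eq = trans (sym (ψφ x)) (trans (cong ψ eq) (ψφ y))
    to : ∀ {x} → x ∈ map φ xs → x ∈ xs
    to x∈ with ∈-map⁻ φ x∈
    ... | _ , y∈ , refl = φ∈ y∈
    from : ∀ {x} → x ∈ xs → x ∈ map φ xs
    from {x} x∈ = subst (_∈ map φ xs) (φψ x) (∈-map⁺ φ (ψ∈ x∈))

  ∑-bijection : {xs : List A} → Enumerates xs → (φ ψ : A → A) →
    (∀ x → φ (ψ x) ≡ x) → (∀ x → ψ (φ x) ≡ x) →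
    (f : A → ℤ) → ∑[ x ← xs ] f (φ x) ≡ ∑ xs f
  ∑-bijection {xs = xs} (u , all) φ ψ φψ ψφ f =
    trans (sym (∑-map φ xs f))
      (foldr-map-↭ (map-bijection-↭ φ ψ u φψ ψφ (λ _ → all _) (λ _ → all _)))
    where
    open import Data.List.Relation.Binary.Permutation.Propositional.Properties using (map⁺)
    foldr-map-↭ : ∀ {xs ys} → xs ↭ ys → ∑ xs f ≡ ∑ ys f
    foldr-map-↭ xs↭ys =
      ↭ₛ.foldr-commMonoid (setoid ℤ) +-0-isCommutativeMonoid (↭⇒↭ₛ (map⁺ f xs↭ys))

-- Counting solutions of quadratic equations over a field with q = 3 + 4k elements.

module FieldSums {q : ℕ} (F : FiniteField q) (k : ℕ) (q≡3+4k : q ≡ 3 ℕ.+ k ℕ.* 4) where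

  open ListSums
  open import Algebra.Bundles using (CommutativeRing)
  open import Algebra.Apartness.Structures using (module IsHeytingField)
  import Algebra.Properties.Ring as RingProperties
  import Algebra.Solver.Ring.NaturalCoefficients.Default as SemiringSolver
  open import Algebra.Structures using (IsCommutativeMonoid)
  open import Data.Integer.Base hiding (suc; _⊖_)
  open import Data.Integer.Properties
    using ( +-identityˡ; +-identityʳ; *-identityˡ; *-identityʳ; *-zeroʳ; *-assoc
          ; *-distribʳ-+; pos-*; *-cancelˡ-≡; *-cancelˡ-≤-pos; i*j≡0⇒i≡0∨j≡0; i-j≡0⇒i≡j
          ; 0≤i-j⇒j≤i; i≤j⇒0≤j-i; ≤-reflexive; ≤-trans; +-mono-≤; *-monoˡ-≤-nonNeg
          ; *-monoʳ-≤-nonNeg; module ≤-Reasoning)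
  open import Data.Integer.Tactic.RingSolver using (solve-∀)
  open import Data.Nat.GeneralisedArithmetic using (fold)
  open import Data.List.Base
    using ( List; []; _∷_; map; foldr; length; filter; allFin; _++_; cartesianProduct
          ; cartesianProductWith)
  open import Data.List.Membership.Propositional using (_∈_)
  open import Data.List.Membership.Propositional.Properties
    using (∈-map⁺; ∈-allFin; ∈-filter⁺; ∈-filter⁻)
  open import Data.List.Properties using (length-map; length-tabulate; length-++)
  open import Data.List.Relation.Binary.Permutation.Propositional using (_↭_; ↭⇒↭ₛ)
  open import Data.List.Relation.Binary.Permutation.Propositional.Properties using (↭-length)
  import Data.List.Relation.Binary.Permutation.Setoid.Properties as ↭ₛ
  import Data.List.Relation.Unary.All as All
  open import Data.List.Relation.Unary.All.Properties using (all-filter)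
  open import Data.List.Relation.Unary.AllPairs using ([]; _∷_)
  open import Data.List.Relation.Unary.Any using (here; there)
  open import Data.List.Relation.Unary.Unique.Propositional using (Unique)
  import Data.List.Relation.Unary.Unique.Propositional.Properties as Unique
  open import Data.Nat.Base using (zero; suc)
  open import Data.Nat.Properties as ℕ using (suc-injective)
  open import Data.Product.Base using (_×_; _,_; proj₁; proj₂; ∃-syntax; uncurry)
  import Data.Product.Properties as ×
  open import Data.Sum.Base using ([_,_]′)
  open import Data.Vec.Base using (Vec; []; _∷_; replicate; zipWith)
  open import Data.Vec.Properties using (≡-dec; ∷-injectiveˡ; ∷-injectiveʳ)
  open import Data.Vec.Relation.Unary.All using (All; []; _∷_)
  open import Function.Base using (_∘_; id)
  open import Function.Bundles using (Inverse)
  open import Relation.Binary.Definitions using (DecidableEquality)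
  open import Relation.Binary.PropositionalEquality
  open import Relation.Nullary.Decidable using (Dec; yes; no; ¬?; _×-dec_)
  open import Relation.Nullary.Negation using (contradiction)

  open FiniteField F public
    renaming ( Carrier to K; _+_ to _⊕_; _*_ to _⊗_; -_ to ⊖_; _-_ to _⊝_
             ; 0# to 𝟘; 1# to 𝟙; _≟_ to infix 4 _≟_)
  module K = CommutativeRing commutativeRing
  module K-Properties = RingProperties K.ring
  open SemiringSolver K.commutativeSemiring using (_:+_; _:*_; _:=_; con) renaming (solve to solveᴷ)

  -- Field arithmetic

  -- The Heyting field axioms give invertibility of differences, so the hypothesis is read as
  -- apartness of x from 𝟘 and x ⊝ 𝟘 is simplified.
  inverse : ∀ {x} → x ≢ 𝟘 → ∃[ y ] y ⊗ x ≡ 𝟙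
  inverse {x} x≢0 with IsHeytingField.#⇒invertible isHeytingField x≢0
  ... | y , y[x-0]≡1 , _ = y , trans (cong (y ⊗_) (sym x-0≡x)) y[x-0]≡1
    where
    x-0≡x : x ⊝ 𝟘 ≡ x
    x-0≡x = trans (cong (x ⊕_) K-Properties.-0#≈0#) (K.+-identityʳ x)

  𝟙≢𝟘 : 𝟙 ≢ 𝟘
  𝟙≢𝟘 = IsHeytingField.invertible⇒# isHeytingField (𝟙 , trans (K.*-comm 𝟙 _) eq′ , eq′)
    where
    eq′ : (𝟙 ⊝ 𝟘) ⊗ 𝟙 ≡ 𝟙
    eq′ = trans (K.*-identityʳ _) (trans (cong (𝟙 ⊕_) K-Properties.-0#≈0#) (K.+-identityʳ 𝟙))


  ⊗-cancelˡ-𝟘 : ∀ {x y} → x ≢ 𝟘 → x ⊗ y ≡ 𝟘 → y ≡ 𝟘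
  ⊗-cancelˡ-𝟘 {x} {y} x≢0 xy≡0 with inverse x≢0
  ... | x⁻¹ , x⁻¹x≡1 = begin
    y              ≡⟨ K.*-identityˡ y ⟨
    𝟙 ⊗ y          ≡⟨ cong (_⊗ y) x⁻¹x≡1 ⟨
    x⁻¹ ⊗ x ⊗ y    ≡⟨ K.*-assoc x⁻¹ x y ⟩
    x⁻¹ ⊗ (x ⊗ y)  ≡⟨ cong (x⁻¹ ⊗_) xy≡0 ⟩
    x⁻¹ ⊗ 𝟘        ≡⟨ K.zeroʳ x⁻¹ ⟩
    𝟘              ∎
    where open ≡-Reasoning

  ⊗-≢𝟘 : ∀ {x y} → x ≢ 𝟘 → y ≢ 𝟘 → x ⊗ y ≢ 𝟘
  ⊗-≢𝟘 x≢0 y≢0 = y≢0 ∘ ⊗-cancelˡ-𝟘 x≢0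

  x⊗x≡𝟘⇒x≡𝟘 : ∀ {x} → x ⊗ x ≡ 𝟘 → x ≡ 𝟘
  x⊗x≡𝟘⇒x≡𝟘 {x} xx≡0 with x ≟ 𝟘
  ... | yes x≡0 = x≡0
  ... | no  x≢0 = ⊗-cancelˡ-𝟘 x≢0 xx≡0

  x⊕y⊝y≡x : ∀ x y → (x ⊕ y) ⊝ y ≡ x
  x⊕y⊝y≡x x y = K-Properties.//-rightDividesʳ y x

  x⊝y⊕y≡x : ∀ x y → (x ⊝ y) ⊕ y ≡ x
  x⊝y⊕y≡x x y = K-Properties.//-rightDividesˡ y x

  elements : List K
  elements = map (Inverse.from enumeration) (allFin q)

  elements-enumerates : Enumerates elements
  elements-enumerates = Unique.map⁺ injective (Unique.allFin⁺ q) , complete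
    where
    injective : ∀ {i j} → Inverse.from enumeration i ≡ Inverse.from enumeration j → i ≡ j
    injective {i} {j} eq = trans (sym (Inverse.strictlyInverseˡ enumeration i))
      (trans (cong (Inverse.to enumeration) eq) (Inverse.strictlyInverseˡ enumeration j))
    complete : ∀ x → x ∈ elements
    complete x = subst (_∈ elements) (Inverse.strictlyInverseʳ enumeration x)
                       (∈-map⁺ _ (∈-allFin (Inverse.to enumeration x)))

  length-elements : length elements ≡ q
  length-elements = trans (length-map _ (allFin q)) (length-tabulate id)

  -- The characteristic is odd, and -1 is not a square

  -- Stated for any commutative monoid because it is applied to the sum of all elements, for
  -- `two≢𝟘`, and to the product of all units, for `i⊗i≢⊖𝟙`.
  module _ {_∙_ : K → K → K} {ε : K} (isCM : IsCommutativeMonoid _≡_ _∙_ ε) where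

    open IsCommutativeMonoid isCM using (assoc; comm)

    fold-∙ : ∀ a x s n → fold (x ∙ s) (a ∙_) n ≡ x ∙ fold s (a ∙_) n
    fold-∙ a x s zero    = refl
    fold-∙ a x s (suc n) = begin
      a ∙ fold (x ∙ s) (a ∙_) n  ≡⟨ cong (a ∙_) (fold-∙ a x s n) ⟩
      a ∙ (x ∙ r)                ≡⟨ assoc a x r ⟨
      (a ∙ x) ∙ r                ≡⟨ cong (_∙ r) (comm a x) ⟩
      (x ∙ a) ∙ r                ≡⟨ assoc x a r ⟩
      x ∙ (a ∙ r)                ∎
      where open ≡-Reasoning
            r = fold s (a ∙_) n

    foldr-map-∙ : ∀ a xs → foldr _∙_ ε (map (a ∙_) xs) ≡ fold (foldr _∙_ ε xs) (a ∙_) (length xs)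
    foldr-map-∙ a []       = refl
    foldr-map-∙ a (x ∷ xs) = begin
      (a ∙ x) ∙ foldr _∙_ ε (map (a ∙_) xs)  ≡⟨ cong ((a ∙ x) ∙_) (foldr-map-∙ a xs) ⟩
      (a ∙ x) ∙ fold s (a ∙_) n              ≡⟨ assoc a x _ ⟩
      a ∙ (x ∙ fold s (a ∙_) n)              ≡⟨ cong (a ∙_) (fold-∙ a x s n) ⟨
      a ∙ fold (x ∙ s) (a ∙_) n              ∎
      where open ≡-Reasoning
            s = foldr _∙_ ε xs
            n = length xs

    -- Translating every entry by a multiplies the total by a once per entry, yet a permutation
    -- leaves the total unchanged.
    translation-invariant⇒fold≡ : ∀ a {xs} → map (a ∙_) xs ↭ xs →
      fold (foldr _∙_ ε xs) (a ∙_) (length xs) ≡ foldr _∙_ ε xs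
    translation-invariant⇒fold≡ a {xs} p =
      trans (sym (foldr-map-∙ a xs)) (↭ₛ.foldr-commMonoid (setoid K) isCM (↭⇒↭ₛ p))

  fold-period-4 : {A : Set} (f : A → A) → (∀ x → f (f (f (f x))) ≡ x) → ∀ x n → fold x f (n ℕ.* 4) ≡ x
  fold-period-4 f f⁴≡id x zero    = refl
  fold-period-4 f f⁴≡id x (suc n) = trans (f⁴≡id _) (fold-period-4 f f⁴≡id x n)

  two : K
  two = 𝟙 ⊕ 𝟙

  -- The map x ↦ 1 + x permutes the field, so adding 1 to the total S of all elements q times gives
  -- back S. If 1 + 1 = 0, these additions cancel in pairs and, q being odd, 1 + S = S would follow.
  two≢𝟘 : two ≢ 𝟘
  two≢𝟘 two≡0 = 𝟙≢𝟘 (K-Properties.+-identityˡ-unique 𝟙 S (trans (sym (+1+1 (𝟙 ⊕ S))) 3S))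
    where
    S = foldr _⊕_ 𝟘 elements
    +1+1 : ∀ x → 𝟙 ⊕ (𝟙 ⊕ x) ≡ x
    +1+1 x = trans (sym (K.+-assoc 𝟙 𝟙 x)) (trans (cong (_⊕ x) two≡0) (K.+-identityˡ x))
    translation : map (𝟙 ⊕_) elements ↭ elements
    translation = map-bijection-↭ (𝟙 ⊕_) (⊖ 𝟙 ⊕_) (proj₁ elements-enumerates)
      (K-Properties.\\-leftDividesˡ 𝟙) (K-Properties.\\-leftDividesʳ 𝟙)
      (λ _ → proj₂ elements-enumerates _) (λ _ → proj₂ elements-enumerates _)
    3S : 𝟙 ⊕ (𝟙 ⊕ (𝟙 ⊕ S)) ≡ S
    3S = begin
      𝟙 ⊕ (𝟙 ⊕ (𝟙 ⊕ S))                  ≡⟨ cong (λ s → 𝟙 ⊕ (𝟙 ⊕ (𝟙 ⊕ s)))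
                                               (fold-period-4 (𝟙 ⊕_) (λ x → trans (+1+1 _) (+1+1 x)) S k) ⟨
      fold S (𝟙 ⊕_) (3 ℕ.+ k ℕ.* 4)      ≡⟨ cong (fold S (𝟙 ⊕_)) (trans length-elements q≡3+4k) ⟨
      fold S (𝟙 ⊕_) (length elements)    ≡⟨ translation-invariant⇒fold≡ K.+-isCommutativeMonoid 𝟙 translation ⟩
      S                                  ∎
      where open ≡-Reasoning

  two-⊗ : ∀ x → two ⊗ x ≡ x ⊕ x
  two-⊗ x = trans (K.distribʳ x 𝟙 𝟙) (cong₂ _⊕_ (K.*-identityˡ x) (K.*-identityˡ x))

  units : List K
  units = filter (λ x → ¬? (x ≟ 𝟘)) elements

  length-units : length units ≡ 2 ℕ.+ k ℕ.* 4
  length-units = suc-injective (trans (↭-length 0∷units↭elements) (trans length-elements q≡3+4k))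
    where
    0∷units↭elements : 𝟘 ∷ units ↭ elements
    0∷units↭elements = unique-↭ (All.map (_∘ sym) (all-filter (λ x → ¬? (x ≟ 𝟘)) elements)
                                   ∷ Unique.filter⁺ (λ x → ¬? (x ≟ 𝟘)) (proj₁ elements-enumerates))
                                (proj₁ elements-enumerates)
                                (λ _ → proj₂ elements-enumerates _) from
      where
      from : ∀ {x} → x ∈ elements → x ∈ 𝟘 ∷ units
      from {x} x∈ with x ≟ 𝟘
      ... | yes x≡0 = here x≡0
      ... | no  x≢0 = there (∈-filter⁺ (λ x → ¬? (x ≟ 𝟘)) x∈ x≢0)

  product-≢𝟘 : ∀ {xs} → All.All (_≢ 𝟘) xs → foldr _⊗_ 𝟙 xs ≢ 𝟘
  product-≢𝟘 All.[]           = 𝟙≢𝟘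
  product-≢𝟘 (x≢0 All.∷ xs≢0) = ⊗-≢𝟘 x≢0 (product-≢𝟘 xs≢0)

  -- Multiplying all units by a square root i of -1 multiplies their product by i^(q-1) = i² = -1.
  i⊗i≢⊖𝟙 : ∀ i → i ⊗ i ≢ ⊖ 𝟙
  i⊗i≢⊖𝟙 i ii≡-1 =
    ⊗-≢𝟘 two≢𝟘 (product-≢𝟘 units≢0) (trans (two-⊗ P) (trans (cong (P ⊕_) P≡-P) (K.-‿inverseʳ P)))
    where
    units≢0 = all-filter (λ x → ¬? (x ≟ 𝟘)) elements
    P = foldr _⊗_ 𝟙 units
    ii : ∀ x → i ⊗ (i ⊗ x) ≡ ⊖ x
    ii x = trans (sym (K.*-assoc i i x)) (trans (cong (_⊗ x) ii≡-1) (K-Properties.-1*x≈-x x))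
    iiii : ∀ x → i ⊗ (i ⊗ (i ⊗ (i ⊗ x))) ≡ x
    iiii x = trans (ii _) (trans (cong ⊖_ (ii x)) (K-Properties.-‿involutive x))
    i≢0 : i ≢ 𝟘
    i≢0 refl = 𝟙≢𝟘 (trans (sym (iiii 𝟙)) (K.zeroˡ _))
    i⊗-∈ : ∀ {x} → x ∈ units → i ⊗ x ∈ units
    i⊗-∈ {x} x∈ = ∈-filter⁺ (λ x → ¬? (x ≟ 𝟘)) (proj₂ elements-enumerates _)
                            (⊗-≢𝟘 i≢0 (proj₂ (∈-filter⁻ (λ x → ¬? (x ≟ 𝟘)) {xs = elements} x∈)))
    multiplication : map (i ⊗_) units ↭ units
    multiplication = map-bijection-↭ (i ⊗_) (λ x → i ⊗ (i ⊗ (i ⊗ x)))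
      (Unique.filter⁺ _ (proj₁ elements-enumerates)) iiii iiii i⊗-∈ (i⊗-∈ ∘ i⊗-∈ ∘ i⊗-∈)
    P≡-P : P ≡ ⊖ P
    P≡-P = begin
      P                               ≡⟨ translation-invariant⇒fold≡ K.*-isCommutativeMonoid i multiplication ⟨
      fold P (i ⊗_) (length units)    ≡⟨ cong (fold P (i ⊗_)) length-units ⟩
      i ⊗ (i ⊗ fold P (i ⊗_) (k ℕ.* 4))  ≡⟨ cong (λ x → i ⊗ (i ⊗ x)) (fold-period-4 (i ⊗_) iiii P k) ⟩
      i ⊗ (i ⊗ P)                     ≡⟨ ii P ⟩
      ⊖ P                             ∎
      where open ≡-Reasoning

  -- Quadratic sums in one and two variables

  ∑ᴷ : (K → ℤ) → ℤ
  ∑ᴷ = ∑ elements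

  ∑ᴷ-const : ∀ c → ∑ᴷ (λ _ → c) ≡ + q * c
  ∑ᴷ-const c = trans (∑-const elements c) (cong (λ n → + n * c) length-elements)

  ∑ᴷ-affine : ∀ a b f → ∑ᴷ (λ x → a + b * f x) ≡ + q * a + b * ∑ᴷ f
  ∑ᴷ-affine a b f = trans (∑-affine elements a b f) (cong (λ n → + n * a + b * ∑ᴷ f) length-elements)

  ∑ᴷ-δ* : ∀ a f → ∑ᴷ (λ x → δ (x ≟ a) * f x) ≡ f a
  ∑ᴷ-δ* a f = ∑-δ _≟_ (proj₁ elements-enumerates) (proj₂ elements-enumerates a) f

  ∑ᴷ-δ : ∀ a → ∑ᴷ (λ x → δ (x ≟ a)) ≡ 1ℤ
  ∑ᴷ-δ a = trans (∑-cong elements (λ x → sym (*-identityʳ (δ (x ≟ a))))) (∑ᴷ-δ* a (λ _ → 1ℤ))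

  ∑ᴷ-translate : ∀ c G → ∑ᴷ (λ x → G (x ⊕ c)) ≡ ∑ᴷ G
  ∑ᴷ-translate c G = ∑-bijection elements-enumerates (_⊕ c) (_⊝ c)
    (λ x → x⊝y⊕y≡x x c) (λ x → x⊕y⊝y≡x x c) G

  ∑ᴷ-negate : ∀ G → ∑ᴷ (λ x → G (⊖ x)) ≡ ∑ᴷ G
  ∑ᴷ-negate = ∑-bijection elements-enumerates ⊖_ ⊖_ K-Properties.-‿involutive K-Properties.-‿involutive

  ∑ᴷ-scale : ∀ {b} → b ≢ 𝟘 → ∀ G → ∑ᴷ (λ x → G (x ⊗ b)) ≡ ∑ᴷ G
  ∑ᴷ-scale {b} b≢0 with inverse b≢0
  ... | b⁻¹ , b⁻¹b≡1 = ∑-bijection elements-enumerates (_⊗ b) (_⊗ b⁻¹)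
    (λ x → trans (K.*-assoc x b⁻¹ b) (trans (cong (x ⊗_) b⁻¹b≡1) (K.*-identityʳ x)))
    (λ x → trans (K.*-assoc x b b⁻¹)
      (trans (cong (x ⊗_) (trans (K.*-comm b b⁻¹) b⁻¹b≡1)) (K.*-identityʳ x)))

  ∑ᴷ-line : ∀ {b} → b ≢ 𝟘 → ∀ c G → ∑ᴷ (λ x → G (x ⊗ b ⊕ c)) ≡ ∑ᴷ G
  ∑ᴷ-line b≢0 c G = trans (∑ᴷ-scale b≢0 (λ y → G (y ⊕ c))) (∑ᴷ-translate c G)

  -- For u ≠ 0 the map v ↦ vu permutes the field; the line u = 0 contributes q copies of G 𝟘.
  ∑∑-uv : ∀ G → ∑ᴷ (λ u → ∑ᴷ (λ v → G (v ⊗ u))) ≡ (+ q - 1ℤ) * ∑ᴷ G + + q * G 𝟘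
  ∑∑-uv G = begin
    ∑ᴷ (λ u → ∑ᴷ (λ v → G (v ⊗ u)))     ≡⟨ ∑-cong elements inner ⟩
    ∑ᴷ (λ u → S + D * δ (u ≟ 𝟘))        ≡⟨ ∑ᴷ-affine S D (λ u → δ (u ≟ 𝟘)) ⟩
    + q * S + D * ∑ᴷ (λ u → δ (u ≟ 𝟘))  ≡⟨ cong (λ s → + q * S + D * s) (∑ᴷ-δ 𝟘) ⟩
    + q * S + D * 1ℤ                    ≡⟨ alg (+ q) S (G 𝟘) ⟩
    (+ q - 1ℤ) * S + + q * G 𝟘          ∎
    where
    open ≡-Reasoning
    S = ∑ᴷ G
    D = + q * G 𝟘 - S
    alg : ∀ q s g → q * s + (q * g - s) * 1ℤ ≡ (q - 1ℤ) * s + q * g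
    alg = solve-∀
    alg′ : ∀ s t → t ≡ s + (t - s) * 1ℤ
    alg′ = solve-∀
    alg″ : ∀ s t → s ≡ s + t * 0ℤ
    alg″ = solve-∀
    inner : ∀ u → ∑ᴷ (λ v → G (v ⊗ u)) ≡ S + D * δ (u ≟ 𝟘)
    inner u with u ≟ 𝟘
    ... | yes refl = trans (trans (∑-cong elements (λ v → cong G (K.zeroʳ v))) (∑ᴷ-const (G 𝟘)))
                           (alg′ S (+ q * G 𝟘))
    ... | no  u≢0  = trans (∑ᴷ-scale u≢0 G) (alg″ S D)

  -- With x = u + y the form becomes (2y + u)u, and for fixed u the factor 2y + u runs over the
  -- field as y does, because 2 ≠ 0. This reduces the hyperbolic plane to the product form.
  ∑∑-x²-y² : ∀ G → ∑ᴷ (λ x → ∑ᴷ (λ y → G (x ⊗ x ⊝ y ⊗ y))) ≡ (+ q - 1ℤ) * ∑ᴷ G + + q * G 𝟘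
  ∑∑-x²-y² G = begin
    ∑ᴷ (λ x → ∑ᴷ (λ y → G (x ⊗ x ⊝ y ⊗ y)))
      ≡⟨ ∑-swap elements elements _ ⟩
    ∑ᴷ (λ y → ∑ᴷ (λ x → G (x ⊗ x ⊝ y ⊗ y)))
      ≡⟨ ∑-cong elements (λ y → ∑ᴷ-translate y (λ x → G (x ⊗ x ⊝ y ⊗ y))) ⟨
    ∑ᴷ (λ y → ∑ᴷ (λ u → G ((u ⊕ y) ⊗ (u ⊕ y) ⊝ y ⊗ y)))
      ≡⟨ ∑-cong elements (λ y → ∑-cong elements (λ u → cong G (factor u y))) ⟩
    ∑ᴷ (λ y → ∑ᴷ (λ u → G ((y ⊗ two ⊕ u) ⊗ u)))
      ≡⟨ ∑-swap elements elements _ ⟩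
    ∑ᴷ (λ u → ∑ᴷ (λ y → G ((y ⊗ two ⊕ u) ⊗ u)))
      ≡⟨ ∑-cong elements (λ u → ∑ᴷ-line two≢𝟘 u (λ v → G (v ⊗ u))) ⟩
    ∑ᴷ (λ u → ∑ᴷ (λ v → G (v ⊗ u)))
      ≡⟨ ∑∑-uv G ⟩
    (+ q - 1ℤ) * ∑ᴷ G + + q * G 𝟘 ∎
    where
    open ≡-Reasoning
    square : ∀ u y → (u ⊕ y) ⊗ (u ⊕ y) ≡ (y ⊗ two ⊕ u) ⊗ u ⊕ y ⊗ y
    square = solveᴷ 2 (λ u y → (u :+ y) :* (u :+ y) := (y :* (con 1 :+ con 1) :+ u) :* u :+ y :* y) refl
    factor : ∀ u y → (u ⊕ y) ⊗ (u ⊕ y) ⊝ y ⊗ y ≡ (y ⊗ two ⊕ u) ⊗ u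
    factor u y = trans (cong (_⊝ y ⊗ y) (square u y)) (x⊕y⊝y≡x _ _)

  -- Equals 1 plus the quadratic character of c, and replaces that character throughout.
  roots : K → ℤ
  roots c = ∑ᴷ λ x → δ (x ⊗ x ≟ c)

  -- Applied to squaring, where the fibre size is `roots`, and to linear functionals on a family of
  -- vectors, where it is `section`.
  ∑-fibres : {A : Set} (xs : List A) (f : A → K) (G : K → ℤ) →
             ∑ᴷ (λ c → (∑[ x ← xs ] δ (f x ≟ c)) * G c) ≡ ∑[ x ← xs ] G (f x)
  ∑-fibres xs f G = begin
    ∑ᴷ (λ c → (∑[ x ← xs ] δ (f x ≟ c)) * G c)
      ≡⟨ ∑-cong elements (λ c → ∑-*ʳ xs _ (G c)) ⟨
    ∑ᴷ (λ c → ∑[ x ← xs ] δ (f x ≟ c) * G c)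
      ≡⟨ ∑-swap elements xs _ ⟩
    ∑[ x ← xs ] ∑ᴷ (λ c → δ (f x ≟ c) * G c)
      ≡⟨ ∑-cong xs (λ x → ∑-cong elements (λ c → cong (_* G c) (δ-cong (f x ≟ c) (c ≟ f x) sym sym))) ⟩
    ∑[ x ← xs ] ∑ᴷ (λ c → δ (c ≟ f x) * G c)
      ≡⟨ ∑-cong xs (λ x → ∑ᴷ-δ* (f x) G) ⟩
    ∑[ x ← xs ] G (f x) ∎
    where open ≡-Reasoning

  ∑-roots* : ∀ G → ∑ᴷ (λ c → roots c * G c) ≡ ∑ᴷ (λ x → G (x ⊗ x))
  ∑-roots* = ∑-fibres elements (λ x → x ⊗ x)

  ∑-roots : ∑ᴷ roots ≡ + q
  ∑-roots = trans (∑-cong elements (λ c → sym (*-identityʳ (roots c))))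
            (trans (∑-roots* (λ _ → 1ℤ)) (trans (∑ᴷ-const 1ℤ) (*-identityʳ (+ q))))

  -- The second moment of `roots` counts pairs with x² = y², which is the fibre of x² - y² over 0.
  ∑-roots² : ∑ᴷ (λ c → roots c * roots c) ≡ (+ q - 1ℤ) * 1ℤ + + q * 1ℤ
  ∑-roots² = begin
    ∑ᴷ (λ c → roots c * roots c)
      ≡⟨ ∑-roots* roots ⟩
    ∑ᴷ (λ x → ∑ᴷ (λ y → δ (y ⊗ y ≟ x ⊗ x)))
      ≡⟨ ∑-cong elements (λ x → ∑-cong elements (λ y → δ-cong (y ⊗ y ≟ x ⊗ x) (x ⊗ x ⊝ y ⊗ y ≟ 𝟘)
           (λ eq → K-Properties.x≈y⇒x∙y⁻¹≈ε (sym eq)) (λ eq → sym (K-Properties.x∙y⁻¹≈ε⇒x≈y _ _ eq)))) ⟩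
    ∑ᴷ (λ x → ∑ᴷ (λ y → δ (x ⊗ x ⊝ y ⊗ y ≟ 𝟘)))
      ≡⟨ ∑∑-x²-y² (λ c → δ (c ≟ 𝟘)) ⟩
    (+ q - 1ℤ) * ∑ᴷ (λ c → δ (c ≟ 𝟘)) + + q * δ (𝟘 ≟ 𝟘)
      ≡⟨ cong₂ (λ a b → (+ q - 1ℤ) * a + + q * b) (∑ᴷ-δ 𝟘) (δ-yes (𝟘 ≟ 𝟘) refl) ⟩
    (+ q - 1ℤ) * 1ℤ + + q * 1ℤ ∎
    where open ≡-Reasoning

  -- Otherwise y/x would be a square root of -1.
  y²≡-x²⇒x≡𝟘 : ∀ x y → y ⊗ y ≡ ⊖ (x ⊗ x) → x ≡ 𝟘
  y²≡-x²⇒x≡𝟘 x y yy≡-xx with x ≟ 𝟘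
  ... | yes x≡0 = x≡0
  ... | no  x≢0 with inverse x≢0
  ...   | x⁻¹ , x⁻¹x≡1 = contradiction eq (i⊗i≢⊖𝟙 (x⁻¹ ⊗ y))
    where
    open ≡-Reasoning
    interchange : ∀ a b → (a ⊗ b) ⊗ (a ⊗ b) ≡ (a ⊗ a) ⊗ (b ⊗ b)
    interchange = solveᴷ 2 (λ a b → (a :* b) :* (a :* b) := (a :* a) :* (b :* b)) refl
    eq : (x⁻¹ ⊗ y) ⊗ (x⁻¹ ⊗ y) ≡ ⊖ 𝟙
    eq = begin
      (x⁻¹ ⊗ y) ⊗ (x⁻¹ ⊗ y)      ≡⟨ interchange x⁻¹ y ⟩
      (x⁻¹ ⊗ x⁻¹) ⊗ (y ⊗ y)      ≡⟨ cong ((x⁻¹ ⊗ x⁻¹) ⊗_) yy≡-xx ⟩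
      (x⁻¹ ⊗ x⁻¹) ⊗ ⊖ (x ⊗ x)    ≡⟨ K-Properties.-‿distribʳ-* _ _ ⟨
      ⊖ ((x⁻¹ ⊗ x⁻¹) ⊗ (x ⊗ x))  ≡⟨ cong ⊖_ (interchange x⁻¹ x) ⟨
      ⊖ ((x⁻¹ ⊗ x) ⊗ (x⁻¹ ⊗ x))  ≡⟨ cong (λ z → ⊖ (z ⊗ z)) x⁻¹x≡1 ⟩
      ⊖ (𝟙 ⊗ 𝟙)                  ≡⟨ cong ⊖_ (K.*-identityˡ 𝟙) ⟩
      ⊖ 𝟙                        ∎

  -- The correlation counts pairs with y² = -x²; the anisotropy of x² + y² leaves only the origin.
  ∑-roots-negate : ∑ᴷ (λ c → roots c * roots (⊖ c)) ≡ 1ℤ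
  ∑-roots-negate = begin
    ∑ᴷ (λ c → roots c * roots (⊖ c))
      ≡⟨ ∑-roots* (λ c → roots (⊖ c)) ⟩
    ∑ᴷ (λ x → ∑ᴷ (λ y → δ (y ⊗ y ≟ ⊖ (x ⊗ x))))
      ≡⟨ ∑-cong elements (λ x → ∑-cong elements (λ y →
           trans (δ-cong (y ⊗ y ≟ ⊖ (x ⊗ x)) ((x ≟ 𝟘) ×-dec (y ≟ 𝟘)) (to x y) from)
                 (δ-× (x ≟ 𝟘) (y ≟ 𝟘)))) ⟩
    ∑ᴷ (λ x → ∑ᴷ (λ y → δ (x ≟ 𝟘) * δ (y ≟ 𝟘)))
      ≡⟨ ∑-product elements elements _ _ ⟩
    ∑ᴷ (λ x → δ (x ≟ 𝟘)) * ∑ᴷ (λ y → δ (y ≟ 𝟘))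
      ≡⟨ cong₂ _*_ (∑ᴷ-δ 𝟘) (∑ᴷ-δ 𝟘) ⟩
    1ℤ ∎
    where
    open ≡-Reasoning
    to : ∀ x y → y ⊗ y ≡ ⊖ (x ⊗ x) → x ≡ 𝟘 × y ≡ 𝟘
    to x y eq with y²≡-x²⇒x≡𝟘 x y eq
    ... | refl = refl , x⊗x≡𝟘⇒x≡𝟘 (trans eq (trans (cong ⊖_ (K.zeroˡ 𝟘)) K-Properties.-0#≈0#))
    from : ∀ {x y} → x ≡ 𝟘 × y ≡ 𝟘 → y ⊗ y ≡ ⊖ (x ⊗ x)
    from (refl , refl) = trans (K.zeroˡ 𝟘) (sym (trans (cong ⊖_ (K.zeroˡ 𝟘)) K-Properties.-0#≈0#))

  -- The squares of roots c + roots (- c) - 2 sum to 2(2q - 1) + 2 - 8q + 4q = 0.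
  roots-±≡2 : ∀ c → roots c + roots (⊖ c) ≡ + 2
  roots-±≡2 c = i-j≡0⇒i≡j (e c) (+ 2)
    ([ id , id ]′ (i*j≡0⇒i≡0∨j≡0 (e c - + 2) (∑-nonNeg-≡0 elements
      (λ c → square-nonNeg (e c - + 2)) total (proj₂ elements-enumerates c))))
    where
    e : K → ℤ
    e c = roots c + roots (⊖ c)
    q′ = + q
    expand : ∀ a b → (a + b - + 2) * (a + b - + 2) ≡
                     a * a + (b * b + (+ 2 * (a * b) + (- + 4 * a + (- + 4 * b + + 4))))
    expand = solve-∀
    collect : ∀ q → ((q - 1ℤ) * 1ℤ + q * 1ℤ) + (((q - 1ℤ) * 1ℤ + q * 1ℤ) +
                    (+ 2 * 1ℤ + (- + 4 * q + (- + 4 * q + q * + 4)))) ≡ 0ℤ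
    collect = solve-∀
    ∑₂ : ∀ f g {a b} → ∑ᴷ f ≡ a → ∑ᴷ g ≡ b → ∑ᴷ (λ c → f c + g c) ≡ a + b
    ∑₂ f g p r = trans (∑-+ elements f g) (cong₂ _+_ p r)
    total : ∑ᴷ (λ c → (e c - + 2) * (e c - + 2)) ≡ 0ℤ
    total = trans (∑-cong elements (λ c → expand (roots c) (roots (⊖ c)))) (trans
      (∑₂ _ _ ∑-roots²
      (∑₂ _ _ (trans (∑ᴷ-negate (λ c → roots c * roots c)) ∑-roots²)
      (∑₂ _ _ (trans (∑-*ˡ elements (+ 2) _) (cong (+ 2 *_) ∑-roots-negate))
      (∑₂ _ _ (trans (∑-*ˡ elements (- + 4) _) (cong (- + 4 *_) ∑-roots))
      (∑₂ _ _ (trans (∑-*ˡ elements (- + 4) _) (cong (- + 4 *_) (trans (∑ᴷ-negate roots) ∑-roots)))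
      (∑ᴷ-const (+ 4)))))))
      (collect q′))

  -- By `roots-±≡2` the values y² and -y² together hit every element exactly twice, so the sums for
  -- x² + y² and x² - y² add up to 2q ∑ᴷ G. The known hyperbolic sum is then subtracted.
  ∑∑-x²+y² : ∀ G → ∑ᴷ (λ x → ∑ᴷ (λ y → G (x ⊗ x ⊕ y ⊗ y))) ≡ (+ q + 1ℤ) * ∑ᴷ G - + q * G 𝟘
  ∑∑-x²+y² G = solve-for (begin
    ∑ᴷ (λ x → ∑ᴷ (λ y → G (x ⊗ x ⊕ y ⊗ y))) + ∑ᴷ (λ x → ∑ᴷ (λ y → G (x ⊗ x ⊝ y ⊗ y)))
      ≡⟨ ∑-+ elements _ _ ⟨
    ∑ᴷ (λ x → ∑ᴷ (λ y → G (x ⊗ x ⊕ y ⊗ y)) + ∑ᴷ (λ y → G (x ⊗ x ⊝ y ⊗ y)))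
      ≡⟨ ∑-cong elements inner ⟩
    ∑ᴷ (λ _ → + 2 * ∑ᴷ G)
      ≡⟨ ∑ᴷ-const _ ⟩
    + q * (+ 2 * ∑ᴷ G) ∎)
    where
    open ≡-Reasoning
    inner : ∀ x → ∑ᴷ (λ y → G (x ⊗ x ⊕ y ⊗ y)) + ∑ᴷ (λ y → G (x ⊗ x ⊝ y ⊗ y)) ≡ + 2 * ∑ᴷ G
    inner x = begin
      ∑ᴷ (λ y → H (y ⊗ y)) + ∑ᴷ (λ y → H (⊖ (y ⊗ y)))
        ≡⟨ cong₂ _+_ (∑-roots* H) (∑-roots* (λ c → H (⊖ c))) ⟨
      ∑ᴷ (λ c → roots c * H c) + ∑ᴷ (λ c → roots c * H (⊖ c))
        ≡⟨ cong (λ s → ∑ᴷ (λ c → roots c * H c) + s) (trans (sym (∑ᴷ-negate (λ c → roots c * H (⊖ c))))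
             (∑-cong elements (λ c → cong (λ c′ → roots (⊖ c) * H c′) (K-Properties.-‿involutive c)))) ⟩
      ∑ᴷ (λ c → roots c * H c) + ∑ᴷ (λ c → roots (⊖ c) * H c)
        ≡⟨ ∑-+ elements _ _ ⟨
      ∑ᴷ (λ c → roots c * H c + roots (⊖ c) * H c)
        ≡⟨ ∑-cong elements (λ c → trans (sym (*-distribʳ-+ (H c) (roots c) (roots (⊖ c))))
                                        (cong (_* H c) (roots-±≡2 c))) ⟩
      ∑ᴷ (λ c → + 2 * H c)
        ≡⟨ ∑-*ˡ elements (+ 2) H ⟩
      + 2 * ∑ᴷ H
        ≡⟨ cong (+ 2 *_) (trans (∑-cong elements (λ c → cong G (K.+-comm (x ⊗ x) c)))
                                (∑ᴷ-translate (x ⊗ x) G)) ⟩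
      + 2 * ∑ᴷ G ∎
      where
      H : K → ℤ
      H c = G (x ⊗ x ⊕ c)
    rearrange : ∀ a b → a ≡ (a + b) - b
    rearrange = solve-∀
    collect : ∀ q s g → q * (+ 2 * s) - ((q - 1ℤ) * s + q * g) ≡ (q + 1ℤ) * s - q * g
    collect = solve-∀
    solve-for : ∀ {a} → a + ∑ᴷ (λ x → ∑ᴷ (λ y → G (x ⊗ x ⊝ y ⊗ y))) ≡ + q * (+ 2 * ∑ᴷ G) →
                a ≡ (+ q + 1ℤ) * ∑ᴷ G - + q * G 𝟘
    solve-for {a} eq = trans (rearrange a _)
      (trans (cong₂ _-_ eq (∑∑-x²-y² G)) (collect (+ q) (∑ᴷ G) (G 𝟘)))

  -- Diagonal quadratic forms

  vectors : ∀ n → List (Vec K n)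
  vectors zero    = [] ∷ []
  vectors (suc n) = cartesianProductWith _∷_ elements (vectors n)

  ∑ⱽ : ∀ n → (Vec K n → ℤ) → ℤ
  ∑ⱽ n = ∑ (vectors n)

  ∑ⱽ-suc : ∀ n f → ∑ⱽ (suc n) f ≡ ∑ᴷ (λ x → ∑ⱽ n (λ v → f (x ∷ v)))
  ∑ⱽ-suc n f = ∑-cartesianProductWith _∷_ elements (vectors n) f

  ∑ⱽ-const : ∀ n c → ∑ⱽ n (λ _ → c) ≡ + (q ℕ.^ n) * c
  ∑ⱽ-const zero    c = trans (+-identityʳ c) (sym (*-identityˡ c))
  ∑ⱽ-const (suc n) c = begin
    ∑ⱽ (suc n) (λ _ → c)           ≡⟨ ∑ⱽ-suc n _ ⟩
    ∑ᴷ (λ _ → ∑ⱽ n (λ _ → c))      ≡⟨ ∑ᴷ-const _ ⟩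
    + q * ∑ⱽ n (λ _ → c)           ≡⟨ cong (+ q *_) (∑ⱽ-const n c) ⟩
    + q * (+ (q ℕ.^ n) * c)        ≡⟨ *-assoc (+ q) _ c ⟨
    + q * + (q ℕ.^ n) * c          ≡⟨ cong (_* c) (pos-* q (q ℕ.^ n)) ⟨
    + (q ℕ.^ suc n) * c            ∎
    where open ≡-Reasoning

  -- The diagonal bilinear form with coefficients a. The bracketing x ⊗ (a ⊗ y) exposes the shape x
  -- ⊗ b ⊕ c that `∑ᴷ-line` expects.
  form : ∀ {n} → Vec K n → Vec K n → Vec K n → K
  form []       []       []       = 𝟘
  form (a ∷ as) (x ∷ xs) (y ∷ ys) = x ⊗ (a ⊗ y) ⊕ form as xs ys

  -- One operation covers the shift of m by a multiple of z and, with r = ⊖ 𝟙, the difference of two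
  -- vectors, so both share the same linearity lemmas.
  _⊞_·_ : ∀ {n} → Vec K n → K → Vec K n → Vec K n
  x ⊞ r · z = zipWith (λ xᵢ zᵢ → xᵢ ⊕ r ⊗ zᵢ) x z

  form-linearʳ : ∀ {n} (a m x : Vec K n) r z → form a m (x ⊞ r · z) ≡ form a m x ⊕ r ⊗ form a m z
  form-linearʳ []       []       []       r []       = solveᴷ 1 (λ r → con 0 := con 0 :+ r :* con 0) refl r
  form-linearʳ (a ∷ as) (m ∷ ms) (x ∷ xs) r (z ∷ zs) = trans
    (cong (m ⊗ (a ⊗ (x ⊕ r ⊗ z)) ⊕_) (form-linearʳ as ms xs r zs))
    (solveᴷ 7 (λ a m x r z X Z → m :* (a :* (x :+ r :* z)) :+ (X :+ r :* Z) :=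
                                 (m :* (a :* x) :+ X) :+ r :* (m :* (a :* z) :+ Z))
      refl a m x r z (form as ms xs) (form as ms zs))

  -- The grouping isolates r²Q z: the bracket is the expression whose zeros `double-count` counts,
  -- and it can be cancelled as a whole.
  form-expand : ∀ {n} (a x : Vec K n) r z → form a (x ⊞ r · z) (x ⊞ r · z) ≡
                (r ⊗ (two ⊗ form a x z) ⊕ form a x x) ⊕ r ⊗ r ⊗ form a z z
  form-expand []       []       r []       =
    solveᴷ 1 (λ r → con 0 := (r :* ((con 1 :+ con 1) :* con 0) :+ con 0) :+ r :* r :* con 0) refl r
  form-expand (a ∷ as) (x ∷ xs) r (z ∷ zs) = trans
    (cong ((x ⊕ r ⊗ z) ⊗ (a ⊗ (x ⊕ r ⊗ z)) ⊕_) (form-expand as xs r zs))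
    (solveᴷ 7 (λ a x r z XZ XX ZZ →
      (x :+ r :* z) :* (a :* (x :+ r :* z)) :+ ((r :* ((con 1 :+ con 1) :* XZ) :+ XX) :+ r :* r :* ZZ) :=
      (r :* ((con 1 :+ con 1) :* (x :* (a :* z) :+ XZ)) :+ (x :* (a :* x) :+ XX))
        :+ r :* r :* (z :* (a :* z) :+ ZZ))
      refl a x r z (form as xs zs) (form as xs xs) (form as zs zs))

  form-zeroʳ : ∀ {n} (a x : Vec K n) → form a x (replicate n 𝟘) ≡ 𝟘
  form-zeroʳ []       []       = refl
  form-zeroʳ (a ∷ as) (x ∷ xs) rewrite form-zeroʳ as xs =
    solveᴷ 2 (λ a x → x :* (a :* con 0) :+ con 0 := con 0) refl a x

  ∑ⱽ-translate : ∀ {n} r (z : Vec K n) G → ∑ⱽ n (λ x → G (x ⊞ r · z)) ≡ ∑ⱽ n G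
  ∑ⱽ-translate         r []       G = refl
  ∑ⱽ-translate {suc n} r (z ∷ zs) G = begin
    ∑ⱽ (suc n) (λ x → G (x ⊞ r · (z ∷ zs)))
      ≡⟨ ∑ⱽ-suc n _ ⟩
    ∑ᴷ (λ x → ∑ⱽ n (λ v → G ((x ⊕ r ⊗ z) ∷ (v ⊞ r · zs))))
      ≡⟨ ∑-cong elements (λ x → ∑ⱽ-translate r zs (λ v → G ((x ⊕ r ⊗ z) ∷ v))) ⟩
    ∑ᴷ (λ x → ∑ⱽ n (λ v → G ((x ⊕ r ⊗ z) ∷ v)))
      ≡⟨ ∑ᴷ-translate (r ⊗ z) (λ x → ∑ⱽ n (λ v → G (x ∷ v))) ⟩
    ∑ᴷ (λ x → ∑ⱽ n (λ v → G (x ∷ v)))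
      ≡⟨ ∑ⱽ-suc n G ⟨
    ∑ⱽ (suc n) G ∎
    where open ≡-Reasoning

  -- At the first nonzero coordinate of z the matching coordinate of m sweeps the functional over
  -- the whole field, whatever the other coordinates are. The factor q on the left avoids the
  -- exponent n - 1.
  ∑ⱽ-linear : ∀ {n} {a : Vec K n} → All (_≢ 𝟘) a → ∀ {z} → z ≢ replicate n 𝟘 → ∀ G →
              + q * ∑ⱽ n (λ m → G (form a m z)) ≡ + (q ℕ.^ n) * ∑ᴷ G
  ∑ⱽ-linear []                          {[]}     z≢0  G = contradiction refl z≢0
  ∑ⱽ-linear {suc n} {a ∷ as} (a≢0 ∷ as≢0) {z ∷ zs} zs≢0 G with z ≟ 𝟘
  ... | yes refl = begin
    + q * ∑ⱽ (suc n) (λ m → G (form (a ∷ as) m (𝟘 ∷ zs)))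
      ≡⟨ cong (+ q *_) (∑ⱽ-suc n _) ⟩
    + q * ∑ᴷ (λ x → ∑ⱽ n (λ m → G (x ⊗ (a ⊗ 𝟘) ⊕ form as m zs)))
      ≡⟨ cong (+ q *_) (∑-cong elements (λ x → ∑-cong (vectors n) (λ m → cong G
           (solveᴷ 3 (λ x a f → x :* (a :* con 0) :+ f := f) refl x a (form as m zs))))) ⟩
    + q * ∑ᴷ (λ x → ∑ⱽ n (λ m → G (form as m zs)))
      ≡⟨ cong (+ q *_) (∑ᴷ-const _) ⟩
    + q * (+ q * ∑ⱽ n (λ m → G (form as m zs)))
      ≡⟨ cong (+ q *_) (∑ⱽ-linear as≢0 (λ eq → zs≢0 (cong (𝟘 ∷_) eq)) G) ⟩
    + q * (+ (q ℕ.^ n) * ∑ᴷ G)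
      ≡⟨ *-assoc (+ q) _ _ ⟨
    + q * + (q ℕ.^ n) * ∑ᴷ G
      ≡⟨ cong (_* ∑ᴷ G) (pos-* q (q ℕ.^ n)) ⟨
    + (q ℕ.^ suc n) * ∑ᴷ G ∎
    where open ≡-Reasoning
  ... | no z≢0 = begin
    + q * ∑ⱽ (suc n) (λ m → G (form (a ∷ as) m (z ∷ zs)))
      ≡⟨ cong (+ q *_) (trans (∑ⱽ-suc n _) (∑-swap elements (vectors n) _)) ⟩
    + q * ∑ⱽ n (λ m → ∑ᴷ (λ x → G (x ⊗ (a ⊗ z) ⊕ form as m zs)))
      ≡⟨ cong (+ q *_) (∑-cong (vectors n) (λ m → ∑ᴷ-line (⊗-≢𝟘 a≢0 z≢0) (form as m zs) G)) ⟩
    + q * ∑ⱽ n (λ _ → ∑ᴷ G)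
      ≡⟨ cong (+ q *_) (∑ⱽ-const n _) ⟩
    + q * (+ (q ℕ.^ n) * ∑ᴷ G)
      ≡⟨ *-assoc (+ q) _ _ ⟨
    + q * + (q ℕ.^ n) * ∑ᴷ G
      ≡⟨ cong (_* ∑ᴷ G) (pos-* q (q ℕ.^ n)) ⟨
    + (q ℕ.^ suc n) * ∑ᴷ G ∎
    where open ≡-Reasoning

  norm : ∀ {n} → Vec K n → K
  norm {n} v = form (replicate n 𝟙) v v

  ∑ⱽ-two-more : ∀ n (H : K → K → Vec K n → ℤ) →
    ∑ᴷ (λ x → ∑ᴷ (λ y → ∑ⱽ n (H x y))) ≡ ∑ⱽ n (λ v → ∑ᴷ (λ x → ∑ᴷ (λ y → H x y v)))
  ∑ⱽ-two-more n H = trans (∑-cong elements (λ x → ∑-swap elements (vectors n) (H x)))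
                          (∑-swap elements (vectors n) _)

  -- Two coordinates are split off as a plane x² + y². Relative to the uniform value q^(n-1) ∑ᴷ G in
  -- dimension n, this multiplies the deviation by -q.
  ∑ⱽ-norm-2+ : ∀ n G → ∑ⱽ (2 ℕ.+ n) (λ v → G (norm v)) ≡
               (+ q + 1ℤ) * (+ (q ℕ.^ n) * ∑ᴷ G) - + q * ∑ⱽ n (λ v → G (norm v))
  ∑ⱽ-norm-2+ n G = begin
    ∑ⱽ (2 ℕ.+ n) (λ v → G (norm v))
      ≡⟨ trans (∑ⱽ-suc (suc n) _) (∑-cong elements (λ x → ∑ⱽ-suc n _)) ⟩
    ∑ᴷ (λ x → ∑ᴷ (λ y → ∑ⱽ n (λ v → G (x ⊗ (𝟙 ⊗ x) ⊕ (y ⊗ (𝟙 ⊗ y) ⊕ norm v)))))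
      ≡⟨ ∑ⱽ-two-more n _ ⟩
    ∑ⱽ n (λ v → ∑ᴷ (λ x → ∑ᴷ (λ y → G (x ⊗ (𝟙 ⊗ x) ⊕ (y ⊗ (𝟙 ⊗ y) ⊕ norm v)))))
      ≡⟨ ∑-cong (vectors n) (λ v → ∑-cong elements (λ x → ∑-cong elements (λ y → cong G
           (solveᴷ 3 (λ x y N → x :* (con 1 :* x) :+ (y :* (con 1 :* y) :+ N) := (x :* x :+ y :* y) :+ N)
             refl x y (norm v))))) ⟩
    ∑ⱽ n (λ v → ∑ᴷ (λ x → ∑ᴷ (λ y → G ((x ⊗ x ⊕ y ⊗ y) ⊕ norm v))))
      ≡⟨ ∑-cong (vectors n) (λ v → trans (∑∑-x²+y² (λ c → G (c ⊕ norm v)))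
           (cong₂ (λ s g → (+ q + 1ℤ) * s - + q * g) (∑ᴷ-translate (norm v) G)
                  (cong G (K.+-identityˡ (norm v))))) ⟩
    ∑ⱽ n (λ v → (+ q + 1ℤ) * ∑ᴷ G - + q * G (norm v))
      ≡⟨ ∑-cong (vectors n) (λ v → alg (+ q) (∑ᴷ G) (G (norm v))) ⟩
    ∑ⱽ n (λ v → (+ q + 1ℤ) * ∑ᴷ G + - + q * G (norm v))
      ≡⟨ trans (∑-+ (vectors n) _ _) (cong₂ _+_ (∑ⱽ-const n _) (∑-*ˡ (vectors n) (- + q) _)) ⟩
    + (q ℕ.^ n) * ((+ q + 1ℤ) * ∑ᴷ G) + - + q * ∑ⱽ n (λ v → G (norm v))
      ≡⟨ alg′ (+ q) (+ (q ℕ.^ n)) (∑ᴷ G) (∑ⱽ n (λ v → G (norm v))) ⟩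
    (+ q + 1ℤ) * (+ (q ℕ.^ n) * ∑ᴷ G) - + q * ∑ⱽ n (λ v → G (norm v)) ∎
    where
    open ≡-Reasoning
    alg : ∀ q s g → (q + 1ℤ) * s - q * g ≡ (q + 1ℤ) * s + - q * g
    alg = solve-∀
    alg′ : ∀ q r s g → r * ((q + 1ℤ) * s) + - q * g ≡ (q + 1ℤ) * (r * s) - q * g
    alg′ = solve-∀


  q^ : ℕ → ℤ
  q^ n = + (q ℕ.^ n)

  q^suc : ∀ n → q^ (suc n) ≡ + q * q^ n
  q^suc n = pos-* q (q ℕ.^ n)

  q^2+ : ∀ n → q^ (2 ℕ.+ n) ≡ + q * (+ q * q^ n)
  q^2+ n = trans (q^suc (suc n)) (cong (+ q *_) (q^suc n))

  q^4j≡q^2j*q^2j : ∀ j → q^ (j ℕ.* 4) ≡ q^ (j ℕ.* 2) * q^ (j ℕ.* 2)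
  q^4j≡q^2j*q^2j zero    = refl
  q^4j≡q^2j*q^2j (suc j) = begin
    q^ (4 ℕ.+ j ℕ.* 4)
      ≡⟨ trans (q^2+ (2 ℕ.+ j ℕ.* 4)) (cong (λ t → + q * (+ q * t)) (q^2+ (j ℕ.* 4))) ⟩
    + q * (+ q * (+ q * (+ q * q^ (j ℕ.* 4))))
      ≡⟨ cong (λ t → + q * (+ q * (+ q * (+ q * t)))) (q^4j≡q^2j*q^2j j) ⟩
    + q * (+ q * (+ q * (+ q * (s * s))))
      ≡⟨ alg (+ q) s ⟩
    (+ q * (+ q * s)) * (+ q * (+ q * s))
      ≡⟨ cong (λ t → t * t) (q^2+ (j ℕ.* 2)) ⟨
    q^ (2 ℕ.+ j ℕ.* 2) * q^ (2 ℕ.+ j ℕ.* 2) ∎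
    where
    open ≡-Reasoning
    s = q^ (j ℕ.* 2)
    alg : ∀ q s → q * (q * (q * (q * (s * s)))) ≡ (q * (q * s)) * (q * (q * s))
    alg = solve-∀

  -- The uniform part is q s² ∑ᴷ G and the deviation is s(∑ᴷ G - q G 𝟘). Dimensions grow in steps of
  -- four, since two applications of the recurrence multiply the deviation by q² and keep its sign;
  -- the base case is the plane x² + y².
  ∑ⱽ-norm : ∀ j G → let s = q^ (j ℕ.* 2) in
    ∑ⱽ (2 ℕ.+ j ℕ.* 4) (λ v → G (norm v)) ≡ (+ q * (s * s) + s) * ∑ᴷ G - + q * (s * G 𝟘)
  ∑ⱽ-norm zero    G = trans (∑ⱽ-norm-2+ 0 G) (alg (+ q) (∑ᴷ G) (G 𝟘))
    where
    alg : ∀ q s g → (q + 1ℤ) * (1ℤ * s) - q * (g + 0ℤ) ≡ (q * (1ℤ * 1ℤ) + 1ℤ) * s - q * (1ℤ * g)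
    alg = solve-∀
  ∑ⱽ-norm (suc j) G = begin
    ∑ⱽ (4 ℕ.+ (2 ℕ.+ j ℕ.* 4)) (λ v → G (norm v))
      ≡⟨ ∑ⱽ-norm-2+ (4 ℕ.+ j ℕ.* 4) G ⟩
    (+ q + 1ℤ) * (q^ (4 ℕ.+ j ℕ.* 4) * S) - + q * ∑ⱽ (4 ℕ.+ j ℕ.* 4) (λ v → G (norm v))
      ≡⟨ cong₂ (λ a b → (+ q + 1ℤ) * (a * S) - + q * b) (q^2+ (2 ℕ.+ j ℕ.* 4))
               (trans (∑ⱽ-norm-2+ (2 ℕ.+ j ℕ.* 4) G)
                      (cong (λ b → (+ q + 1ℤ) * (Q * S) - + q * b) (∑ⱽ-norm j G))) ⟩
    (+ q + 1ℤ) * (+ q * (+ q * Q) * S) -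
      + q * ((+ q + 1ℤ) * (Q * S) - + q * ((+ q * (s * s) + s) * S - + q * (s * G 𝟘)))
      ≡⟨ cong (λ t → (+ q + 1ℤ) * (+ q * (+ q * t) * S) -
                + q * ((+ q + 1ℤ) * (t * S) - + q * ((+ q * (s * s) + s) * S - + q * (s * G 𝟘)))) Q≡ ⟩
    (+ q + 1ℤ) * (+ q * (+ q * (+ q * (+ q * (s * s)))) * S) -
      + q * ((+ q + 1ℤ) * (+ q * (+ q * (s * s)) * S) -
             + q * ((+ q * (s * s) + s) * S - + q * (s * G 𝟘)))
      ≡⟨ alg (+ q) s S (G 𝟘) ⟩
    (+ q * ((+ q * (+ q * s)) * (+ q * (+ q * s))) + (+ q * (+ q * s))) * S -
      + q * ((+ q * (+ q * s)) * G 𝟘)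
      ≡⟨ cong (λ t → (+ q * (t * t) + t) * S - + q * (t * G 𝟘)) (q^2+ (j ℕ.* 2)) ⟨
    (+ q * (q^ (2 ℕ.+ j ℕ.* 2) * q^ (2 ℕ.+ j ℕ.* 2)) + q^ (2 ℕ.+ j ℕ.* 2)) * S -
      + q * (q^ (2 ℕ.+ j ℕ.* 2) * G 𝟘) ∎
    where
    open ≡-Reasoning
    s = q^ (j ℕ.* 2)
    S = ∑ᴷ G
    Q = q^ (2 ℕ.+ j ℕ.* 4)
    Q≡ : Q ≡ + q * (+ q * (s * s))
    Q≡ = trans (q^2+ (j ℕ.* 4)) (cong (λ t → + q * (+ q * t)) (q^4j≡q^2j*q^2j j))
    alg : ∀ q s S g →
      (q + 1ℤ) * (q * (q * (q * (q * (s * s)))) * S) -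
        q * ((q + 1ℤ) * (q * (q * (s * s)) * S) - q * ((q * (s * s) + s) * S - q * (s * g))) ≡
      (q * ((q * (q * s)) * (q * (q * s))) + (q * (q * s))) * S - q * ((q * (q * s)) * g)
    alg = solve-∀

  -- The elliptic form -t² + x₁² + ⋯ + x_d² for d = 3 + 4j.

  module Elliptic (j : ℕ) where

    d n : ℕ
    d = 3 ℕ.+ j ℕ.* 4
    n = suc d

    -- q^(n/2 - 1)
    p : ℤ
    p = q^ (1 ℕ.+ j ℕ.* 2)

    signs : Vec K n
    signs = ⊖ 𝟙 ∷ replicate d 𝟙

    ⟨_,_⟩ : Vec K n → Vec K n → K
    ⟨ x , y ⟩ = form signs x y

    Q : Vec K n → K
    Q x = ⟨ x , x ⟩

    q^n : q^ n ≡ + q * p * (+ q * p)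
    q^n = begin
      q^ (4 ℕ.+ j ℕ.* 4)
        ≡⟨ q^4j≡q^2j*q^2j (suc j) ⟩
      q^ (suc j ℕ.* 2) * q^ (suc j ℕ.* 2)
        ≡⟨ cong (λ t → t * t) (q^suc (1 ℕ.+ j ℕ.* 2)) ⟩
      + q * p * (+ q * p) ∎
      where open ≡-Reasoning

    -- The coordinate t is paired with the first x into a hyperbolic plane, which leaves the norm in
    -- d - 1 = 2 + 4j variables. The plane multiplies the deviation by +q, taking s to p = q s
    -- without changing its sign.
    ∑ⱽ-Q : ∀ G → ∑ⱽ n (λ v → G (Q v)) ≡ (+ q * (p * p) + p) * ∑ᴷ G - + q * (p * G 𝟘)
    ∑ⱽ-Q G = begin
      ∑ⱽ n (λ v → G (Q v))
        ≡⟨ trans (∑ⱽ-suc d _) (trans (∑-cong elements (λ t → ∑ⱽ-suc k′ _)) (∑-swap elements elements _)) ⟩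
      ∑ᴷ (λ x → ∑ᴷ (λ t → ∑ⱽ k′ (λ v → G (t ⊗ (⊖ 𝟙 ⊗ t) ⊕ (x ⊗ (𝟙 ⊗ x) ⊕ norm v)))))
        ≡⟨ ∑ⱽ-two-more k′ _ ⟩
      ∑ⱽ k′ (λ v → ∑ᴷ (λ x → ∑ᴷ (λ t → G (t ⊗ (⊖ 𝟙 ⊗ t) ⊕ (x ⊗ (𝟙 ⊗ x) ⊕ norm v)))))
        ≡⟨ ∑-cong (vectors k′) (λ v → ∑-cong elements (λ x → ∑-cong elements (λ t →
             cong G (regroup x t (norm v))))) ⟩
      ∑ⱽ k′ (λ v → ∑ᴷ (λ x → ∑ᴷ (λ t → G ((x ⊗ x ⊝ t ⊗ t) ⊕ norm v))))
        ≡⟨ ∑-cong (vectors k′) (λ v → trans (∑∑-x²-y² (λ c → G (c ⊕ norm v)))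
             (cong₂ (λ s g → (+ q - 1ℤ) * s + + q * g) (∑ᴷ-translate (norm v) G)
                    (cong G (K.+-identityˡ (norm v))))) ⟩
      ∑ⱽ k′ (λ v → (+ q - 1ℤ) * S + + q * G (norm v))
        ≡⟨ trans (∑-+ (vectors k′) _ _) (cong₂ _+_ (∑ⱽ-const k′ _) (∑-*ˡ (vectors k′) (+ q) _)) ⟩
      q^ k′ * ((+ q - 1ℤ) * S) + + q * ∑ⱽ k′ (λ v → G (norm v))
        ≡⟨ cong₂ (λ a b → a * ((+ q - 1ℤ) * S) + + q * b)
                 (trans (q^2+ (j ℕ.* 4)) (cong (λ t → + q * (+ q * t)) (q^4j≡q^2j*q^2j j)))
                 (∑ⱽ-norm j G) ⟩
      + q * (+ q * (s * s)) * ((+ q - 1ℤ) * S) + + q * ((+ q * (s * s) + s) * S - + q * (s * G 𝟘))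
        ≡⟨ alg (+ q) s S (G 𝟘) ⟩
      (+ q * ((+ q * s) * (+ q * s)) + (+ q * s)) * S - + q * ((+ q * s) * G 𝟘)
        ≡⟨ cong (λ t → (+ q * (t * t) + t) * S - + q * (t * G 𝟘)) (q^suc (j ℕ.* 2)) ⟨
      (+ q * (p * p) + p) * S - + q * (p * G 𝟘) ∎
      where
      open ≡-Reasoning
      k′ = 2 ℕ.+ j ℕ.* 4
      s = q^ (j ℕ.* 2)
      S = ∑ᴷ G
      alg : ∀ q s S g →
        q * (q * (s * s)) * ((q - 1ℤ) * S) + q * ((q * (s * s) + s) * S - q * (s * g)) ≡
        (q * ((q * s) * (q * s)) + (q * s)) * S - q * ((q * s) * g)
      alg = solve-∀
      regroup : ∀ x t N → t ⊗ (⊖ 𝟙 ⊗ t) ⊕ (x ⊗ (𝟙 ⊗ x) ⊕ N) ≡ (x ⊗ x ⊝ t ⊗ t) ⊕ N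
      regroup x t N = trans
        (solveᴷ 4 (λ x t e N → t :* (e :* t) :+ (x :* (con 1 :* x) :+ N) := (x :* x :+ e :* (t :* t)) :+ N)
          refl x t (⊖ 𝟙) N)
        (cong (λ z → (x ⊗ x ⊕ z) ⊕ N) (K-Properties.-1*x≈-x (t ⊗ t)))

    ∑ⱽ-Q-level : ∀ c → ∑ⱽ n (λ v → δ (Q v ≟ c)) ≡ (+ q * (p * p) + p) - + q * (p * δ (𝟘 ≟ c))
    ∑ⱽ-Q-level c = trans (∑ⱽ-Q (λ x → δ (x ≟ c)))
      (cong (_- + q * (p * δ (𝟘 ≟ c)))
            (trans (cong ((+ q * (p * p) + p) *_) (∑ᴷ-δ c)) (*-identityʳ (+ q * (p * p) + p))))

    polarCount : Vec K n → ℤ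
    polarCount z = ∑ⱽ n λ m → δ (Q m ≟ 𝟘) * δ (⟨ m , z ⟩ ≟ 𝟘)

    signs-≢𝟘 : All (_≢ 𝟘) signs
    signs-≢𝟘 = -1≢0 ∷ ones d
      where
      -1≢0 : ⊖ 𝟙 ≢ 𝟘
      -1≢0 eq = 𝟙≢𝟘 (trans (sym (K-Properties.-‿involutive 𝟙)) (trans (cong ⊖_ eq) K-Properties.-0#≈0#))
      ones : ∀ n → All (_≢ 𝟘) (replicate n 𝟙)
      ones zero    = []
      ones (suc n) = 𝟙≢𝟘 ∷ ones n

    -- Both sides count the pairs (m , r) with Q m + 2r⟨m,z⟩ = 0: on the left by solving for r,
    -- on the right by substituting m + rz for m, as Q (m + rz) = Q m + 2r⟨m,z⟩ + r²Q z.
    double-count : ∀ z →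
      q^ n + (+ q * polarCount z - ∑ⱽ n (λ m → δ (⟨ m , z ⟩ ≟ 𝟘))) ≡
      ∑ᴷ (λ r → ∑ⱽ n (λ m → δ (Q m ≟ r ⊗ r ⊗ Q z)))
    double-count z = begin
      q^ n + (+ q * polarCount z - Λ)
        ≡⟨ alg (q^ n) (+ q) (polarCount z) Λ ⟩
      q^ n * 1ℤ + (+ q * polarCount z + -1ℤ * Λ)
        ≡⟨ cong₂ _+_ (∑ⱽ-const n 1ℤ) (trans (∑-+ (vectors n) _ _)
             (cong₂ _+_ (∑-*ˡ (vectors n) (+ q) _) (∑-*ˡ (vectors n) -1ℤ _))) ⟨
      ∑ⱽ n (λ _ → 1ℤ) + ∑ⱽ n (λ m → + q * (δ (Q m ≟ 𝟘) * δ (⟨ m , z ⟩ ≟ 𝟘)) + -1ℤ * δ (⟨ m , z ⟩ ≟ 𝟘))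
        ≡⟨ ∑-+ (vectors n) _ _ ⟨
      ∑ⱽ n (λ m → 1ℤ + (+ q * (δ (Q m ≟ 𝟘) * δ (⟨ m , z ⟩ ≟ 𝟘)) + -1ℤ * δ (⟨ m , z ⟩ ≟ 𝟘)))
        ≡⟨ ∑-cong (vectors n) solutions ⟨
      ∑ⱽ n (λ m → ∑ᴷ (λ r → δ (r ⊗ (two ⊗ ⟨ m , z ⟩) ⊕ Q m ≟ 𝟘)))
        ≡⟨ ∑-swap (vectors n) elements _ ⟩
      ∑ᴷ (λ r → ∑ⱽ n (λ m → δ (r ⊗ (two ⊗ ⟨ m , z ⟩) ⊕ Q m ≟ 𝟘)))
        ≡⟨ ∑-cong elements (λ r → ∑-cong (vectors n) (λ m → δ-cong (_ ≟ _) (_ ≟ _) (to r m) (from r m))) ⟩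
      ∑ᴷ (λ r → ∑ⱽ n (λ m → δ (Q (m ⊞ r · z) ≟ r ⊗ r ⊗ Q z)))
        ≡⟨ ∑-cong elements (λ r → ∑ⱽ-translate r z (λ m → δ (Q m ≟ r ⊗ r ⊗ Q z))) ⟩
      ∑ᴷ (λ r → ∑ⱽ n (λ m → δ (Q m ≟ r ⊗ r ⊗ Q z))) ∎
      where
      open ≡-Reasoning
      Λ = ∑ⱽ n (λ m → δ (⟨ m , z ⟩ ≟ 𝟘))
      alg : ∀ a b c e → a + (b * c - e) ≡ a * 1ℤ + (b * c + -1ℤ * e)
      alg = solve-∀
      alg′ : ∀ a b → a * b ≡ 1ℤ + (a * (b * 1ℤ) + -1ℤ * 1ℤ)
      alg′ = solve-∀
      alg″ : ∀ a b → 1ℤ ≡ 1ℤ + (a * (b * 0ℤ) + -1ℤ * 0ℤ)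
      alg″ = solve-∀
      to : ∀ r m → r ⊗ (two ⊗ ⟨ m , z ⟩) ⊕ Q m ≡ 𝟘 → Q (m ⊞ r · z) ≡ r ⊗ r ⊗ Q z
      to r m eq = trans (form-expand signs m r z) (trans (cong (_⊕ r ⊗ r ⊗ Q z) eq) (K.+-identityˡ _))
      from : ∀ r m → Q (m ⊞ r · z) ≡ r ⊗ r ⊗ Q z → r ⊗ (two ⊗ ⟨ m , z ⟩) ⊕ Q m ≡ 𝟘
      from r m eq = K-Properties.+-identityˡ-unique _ _ (trans (sym (form-expand signs m r z)) eq)
      solutions : ∀ m → ∑ᴷ (λ r → δ (r ⊗ (two ⊗ ⟨ m , z ⟩) ⊕ Q m ≟ 𝟘)) ≡
                  1ℤ + (+ q * (δ (Q m ≟ 𝟘) * δ (⟨ m , z ⟩ ≟ 𝟘)) + -1ℤ * δ (⟨ m , z ⟩ ≟ 𝟘))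
      solutions m with ⟨ m , z ⟩ ≟ 𝟘
      ... | yes eq rewrite eq = trans
        (trans (∑-cong elements (λ r → cong (λ x → δ (x ≟ 𝟘))
                 (solveᴷ 2 (λ r x → r :* ((con 1 :+ con 1) :* con 0) :+ x := x) refl r (Q m))))
               (∑ᴷ-const _))
        (alg′ (+ q) (δ (Q m ≟ 𝟘)))
      ... | no neq = trans (trans (∑ᴷ-line (⊗-≢𝟘 two≢𝟘 neq) (Q m) (λ x → δ (x ≟ 𝟘))) (∑ᴷ-δ 𝟘))
                           (alg″ (+ q) (δ (Q m ≟ 𝟘)))

    q-1 : ℤ
    q-1 = + q - 1ℤ

    ∑ᴷ-δ-r²c : ∀ c → ∑ᴷ (λ r → δ (𝟘 ≟ r ⊗ r ⊗ c)) ≡ 1ℤ + q-1 * δ (c ≟ 𝟘)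
    ∑ᴷ-δ-r²c c with c ≟ 𝟘
    ... | yes refl = trans (∑-cong elements (λ r → δ-yes (𝟘 ≟ r ⊗ r ⊗ 𝟘) (sym (K.zeroʳ _))))
                     (trans (∑ᴷ-const 1ℤ) (alg (+ q)))
      where
      alg : ∀ q → q * 1ℤ ≡ 1ℤ + (q - 1ℤ) * 1ℤ
      alg = solve-∀
    ... | no c≢0 = trans (∑-cong elements (λ r → δ-cong (𝟘 ≟ r ⊗ r ⊗ c) (r ≟ 𝟘) to from))
                   (trans (∑ᴷ-δ 𝟘) (alg q-1))
      where
      alg : ∀ a → 1ℤ ≡ 1ℤ + a * 0ℤ
      alg = solve-∀
      to : ∀ {r} → 𝟘 ≡ r ⊗ r ⊗ c → r ≡ 𝟘
      to eq = x⊗x≡𝟘⇒x≡𝟘 (⊗-cancelˡ-𝟘 c≢0 (trans (K.*-comm c _) (sym eq)))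
      from : ∀ {r} → r ≡ 𝟘 → 𝟘 ≡ r ⊗ r ⊗ c
      from refl = sym (trans (K.*-assoc 𝟘 𝟘 c) (K.zeroˡ _))

    -- Follows from `double-count` by inserting the fibre sizes of `Q` and the size of the
    -- hyperplane orthogonal to z. One factor q comes with `polarCount` in `double-count`, the other
    -- from `∑ⱽ-linear`; both are cancelled in `polarCount-⊟`.
    polarCount-≢0 : ∀ {z} → z ≢ replicate n 𝟘 →
                    + q * (+ q * polarCount z) ≡ + q * (+ q * (p * p - q-1 * (p * δ (Q z ≟ 𝟘))))
    polarCount-≢0 {z} z≢0 = begin
      + q * (+ q * W)
        ≡⟨ rearrange (+ q) (q^ n) W Λ ⟩
      + q * (q^ n + (+ q * W - Λ)) - + q * q^ n + + q * Λ
        ≡⟨ cong₂ _+_ (cong (λ t → + q * t - + q * q^ n) (trans (double-count z) right)) Λ≡ ⟩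
      + q * (+ q * (+ q * (p * p) + p) + - (+ q * p) * (1ℤ + q-1 * ε)) - + q * q^ n + q^ n
        ≡⟨ cong (λ t → + q * (+ q * (+ q * (p * p) + p) + - (+ q * p) * (1ℤ + q-1 * ε)) - + q * t + t) q^n ⟩
      + q * (+ q * (+ q * (p * p) + p) + - (+ q * p) * (1ℤ + q-1 * ε))
          - + q * (+ q * p * (+ q * p)) + + q * p * (+ q * p)
        ≡⟨ alg (+ q) p ε ⟩
      + q * (+ q * (p * p - q-1 * (p * ε))) ∎
      where
      open ≡-Reasoning
      W = polarCount z
      Λ = ∑ⱽ n (λ m → δ (⟨ m , z ⟩ ≟ 𝟘))
      ε = δ (Q z ≟ 𝟘)
      rearrange : ∀ q r w l → q * (q * w) ≡ q * (r + (q * w - l)) - q * r + q * l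
      rearrange = solve-∀
      alg : ∀ q p e → q * (q * (q * (p * p) + p) + - (q * p) * (1ℤ + (q - 1ℤ) * e)) - q * (q * p * (q * p))
                        + q * p * (q * p) ≡ q * (q * (p * p - (q - 1ℤ) * (p * e)))
      alg = solve-∀
      level : ∀ q p e → (q * (p * p) + p) - q * (p * e) ≡ (q * (p * p) + p) + - (q * p) * e
      level = solve-∀
      Λ≡ : + q * Λ ≡ q^ n
      Λ≡ = trans (∑ⱽ-linear signs-≢𝟘 z≢0 (λ x → δ (x ≟ 𝟘)))
                 (trans (cong (q^ n *_) (∑ᴷ-δ 𝟘)) (*-identityʳ (q^ n)))
      right : ∑ᴷ (λ r → ∑ⱽ n (λ m → δ (Q m ≟ r ⊗ r ⊗ Q z))) ≡
              + q * (+ q * (p * p) + p) + - (+ q * p) * (1ℤ + q-1 * ε)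
      right = trans (∑-cong elements (λ r → trans (∑ⱽ-Q-level (r ⊗ r ⊗ Q z)) (level (+ q) p _)))
             (trans (∑ᴷ-affine (+ q * (p * p) + p) (- (+ q * p)) (λ r → δ (𝟘 ≟ r ⊗ r ⊗ Q z)))
                    (cong (λ t → + q * (+ q * (p * p) + p) + - (+ q * p) * t) (∑ᴷ-δ-r²c (Q z))))

    polarCount-≡0 : polarCount (replicate n 𝟘) ≡ (+ q * (p * p) + p) - + q * p
    polarCount-≡0 = begin
      polarCount (replicate n 𝟘)
        ≡⟨ ∑-cong (vectors n) (λ m → trans
             (cong (δ (Q m ≟ 𝟘) *_) (δ-yes (_ ≟ 𝟘) (form-zeroʳ signs m))) (*-identityʳ _)) ⟩
      ∑ⱽ n (λ m → δ (Q m ≟ 𝟘))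
        ≡⟨ ∑ⱽ-Q-level 𝟘 ⟩
      (+ q * (p * p) + p) - + q * (p * δ (𝟘 ≟ 𝟘))
        ≡⟨ cong (λ t → (+ q * (p * p) + p) - + q * t)
                (trans (cong (p *_) (δ-yes (𝟘 ≟ 𝟘) refl)) (*-identityʳ p)) ⟩
      (+ q * (p * p) + p) - + q * p ∎
      where open ≡-Reasoning

    infix 4 _≟ⱽ_
    _≟ⱽ_ : ∀ {n} → DecidableEquality (Vec K n)
    _≟ⱽ_ = ≡-dec _≟_

    infixl 6 _⊟_
    _⊟_ : ∀ {n} → Vec K n → Vec K n → Vec K n
    x ⊟ y = x ⊞ ⊖ 𝟙 · y

    ⊟-cancel : ∀ {n} (x y : Vec K n) → x ⊟ y ≡ replicate n 𝟘 → x ≡ y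
    ⊟-cancel []       []       eq = refl
    ⊟-cancel (x ∷ xs) (y ∷ ys) eq = cong₂ _∷_
      (K-Properties.x∙y⁻¹≈ε⇒x≈y x y
        (trans (cong (x ⊕_) (sym (K-Properties.-1*x≈-x y))) (∷-injectiveˡ eq)))
      (⊟-cancel xs ys (∷-injectiveʳ eq))

    x⊟x≡0 : ∀ {n} (x : Vec K n) → x ⊟ x ≡ replicate n 𝟘
    x⊟x≡0 []       = refl
    x⊟x≡0 (x ∷ xs) = cong₂ _∷_ (trans (cong (x ⊕_) (K-Properties.-1*x≈-x x)) (K.-‿inverseʳ x)) (x⊟x≡0 xs)

    instance
      q-nonZero : ℕ.NonZero q
      q-nonZero = subst ℕ.NonZero (sym q≡3+4k) _

    -- The three cases are merged into one affine expression in two indicators, so that summation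
    -- over pairs is linear. The isotropy indicator also equals 1 when x = y, where the count is q
    -- p² - (q-1)p; hence the equality indicator only has to supply (q-1)p².
    polarCount-⊟ : ∀ x y → polarCount (x ⊟ y) ≡
                   p * p + (- (q-1 * p) * δ (Q (x ⊟ y) ≟ 𝟘) + q-1 * (p * p) * δ (x ≟ⱽ y))
    polarCount-⊟ x y with x ≟ⱽ y
    ... | yes refl = begin
      polarCount (x ⊟ x)
        ≡⟨ trans (cong polarCount (x⊟x≡0 x)) polarCount-≡0 ⟩
      (+ q * (p * p) + p) - + q * p
        ≡⟨ alg (+ q) p ⟩
      p * p + (- (q-1 * p) * 1ℤ + q-1 * (p * p) * 1ℤ)
        ≡⟨ cong (λ t → p * p + (- (q-1 * p) * t + q-1 * (p * p) * 1ℤ))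
             (δ-yes (Q (x ⊟ x) ≟ 𝟘) (trans (cong Q (x⊟x≡0 x)) (form-zeroʳ signs (replicate n 𝟘)))) ⟨
      p * p + (- (q-1 * p) * δ (Q (x ⊟ x) ≟ 𝟘) + q-1 * (p * p) * 1ℤ) ∎
      where
      open ≡-Reasoning
      alg : ∀ q p → (q * (p * p) + p) - q * p ≡ p * p + (- ((q - 1ℤ) * p) * 1ℤ + (q - 1ℤ) * (p * p) * 1ℤ)
      alg = solve-∀
    ... | no x≢y = trans
      (*-cancelˡ-≡ (+ q) _ _ (*-cancelˡ-≡ (+ q) _ _ (polarCount-≢0 (x≢y ∘ ⊟-cancel x y))))
      (alg p q-1 (δ (Q (x ⊟ y) ≟ 𝟘)))
      where
      alg : ∀ p a e → p * p - a * (p * e) ≡ p * p + (- (a * p) * e + a * (p * p) * 0ℤ)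
      alg = solve-∀

    -- Second moments of hyperplane sections in isotropic directions.

    module _ (E : List (Vec K n)) where

      section : Vec K n → K → ℤ
      section m c = ∑[ x ← E ] δ (⟨ m , x ⟩ ≟ c)

      ∑-section : ∀ m → ∑ᴷ (section m) ≡ + length E
      ∑-section m = begin
        ∑ᴷ (section m)
          ≡⟨ ∑-cong elements (λ c → *-identityʳ (section m c)) ⟨
        ∑ᴷ (λ c → section m c * 1ℤ)
          ≡⟨ ∑-fibres E (λ x → ⟨ m , x ⟩) (λ _ → 1ℤ) ⟩
        ∑ E (λ _ → 1ℤ)
          ≡⟨ trans (∑-const E 1ℤ) (*-identityʳ (+ length E)) ⟩
        + length E ∎
        where open ≡-Reasoning

      -- A sum of squared section sizes counts the pairs lying in a common section, that is, the
      -- pairs whose difference is orthogonal to m.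
      ∑-section² : ∀ m → ∑ᴷ (λ c → section m c * section m c) ≡
                   ∑[ x ← E ] ∑[ y ← E ] δ (⟨ m , x ⊟ y ⟩ ≟ 𝟘)
      ∑-section² m = trans (∑-fibres E (λ x → ⟨ m , x ⟩) (section m)) (∑-cong E (λ x → ∑-cong E (λ y →
        δ-cong (⟨ m , y ⟩ ≟ ⟨ m , x ⟩) (⟨ m , x ⊟ y ⟩ ≟ 𝟘)
          (λ eq → trans (expand x y) (K-Properties.x≈y⇒x∙y⁻¹≈ε (sym eq)))
          (λ eq → sym (K-Properties.x∙y⁻¹≈ε⇒x≈y _ _ (trans (sym (expand x y)) eq))))))
        where
        expand : ∀ x y → ⟨ m , x ⊟ y ⟩ ≡ ⟨ m , x ⟩ ⊝ ⟨ m , y ⟩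
        expand x y = trans (form-linearʳ signs m x (⊖ 𝟙) y)
                           (cong (⟨ m , x ⟩ ⊕_) (K-Properties.-1*x≈-x ⟨ m , y ⟩))

      isotropicPairs equalPairs : ℤ
      isotropicPairs = ∑[ x ← E ] ∑[ y ← E ] δ (Q (x ⊟ y) ≟ 𝟘)
      equalPairs     = ∑[ x ← E ] ∑[ y ← E ] δ (x ≟ⱽ y)

      private
        ∣E∣ : ℤ
        ∣E∣ = + length E

      ∑∑-polarCount : ∑[ x ← E ] ∑[ y ← E ] polarCount (x ⊟ y) ≡
        ∣E∣ * (∣E∣ * (p * p)) + (- (q-1 * p) * isotropicPairs + q-1 * (p * p) * equalPairs)
      ∑∑-polarCount = begin
        ∑[ x ← E ] ∑[ y ← E ] polarCount (x ⊟ y)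
          ≡⟨ ∑-cong E (λ x → trans (∑-cong E (polarCount-⊟ x)) (linear (p * p) a b _ _)) ⟩
        ∑[ x ← E ] (∣E∣ * (p * p) + (a * (∑[ y ← E ] δ (Q (x ⊟ y) ≟ 𝟘)) + b * (∑[ y ← E ] δ (x ≟ⱽ y))))
          ≡⟨ linear (∣E∣ * (p * p)) a b _ _ ⟩
        ∣E∣ * (∣E∣ * (p * p)) + (a * isotropicPairs + b * equalPairs) ∎
        where
        open ≡-Reasoning
        a = - (q-1 * p)
        b = q-1 * (p * p)
        linear : ∀ c a b (f g : Vec K n → ℤ) →
                 ∑[ x ← E ] (c + (a * f x + b * g x)) ≡ ∣E∣ * c + (a * ∑ E f + b * ∑ E g)
        linear c a b f g = trans (∑-+ E _ _) (cong₂ _+_ (∑-const E c)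
          (trans (∑-+ E _ _) (cong₂ _+_ (∑-*ˡ E a f) (∑-*ˡ E b g))))

      ∑-isotropic-section² : ∑ⱽ n (λ m → δ (Q m ≟ 𝟘) * ∑ᴷ (λ c → section m c * section m c)) ≡
                             ∑[ x ← E ] ∑[ y ← E ] polarCount (x ⊟ y)
      ∑-isotropic-section² = begin
        ∑ⱽ n (λ m → δ (Q m ≟ 𝟘) * ∑ᴷ (λ c → section m c * section m c))
          ≡⟨ ∑-cong (vectors n) (λ m → trans (cong (δ (Q m ≟ 𝟘) *_) (∑-section² m))
               (trans (sym (∑-*ˡ E (δ (Q m ≟ 𝟘)) _)) (∑-cong E (λ x → sym (∑-*ˡ E (δ (Q m ≟ 𝟘)) _))))) ⟩
        ∑ⱽ n (λ m → ∑[ x ← E ] ∑[ y ← E ] δ (Q m ≟ 𝟘) * δ (⟨ m , x ⊟ y ⟩ ≟ 𝟘))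
          ≡⟨ ∑-swap (vectors n) E _ ⟩
        ∑[ x ← E ] ∑ⱽ n (λ m → ∑[ y ← E ] δ (Q m ≟ 𝟘) * δ (⟨ m , x ⊟ y ⟩ ≟ 𝟘))
          ≡⟨ ∑-cong E (λ x → ∑-swap (vectors n) E _) ⟩
        ∑[ x ← E ] ∑[ y ← E ] polarCount (x ⊟ y) ∎
        where open ≡-Reasoning

      -- For each isotropic m, the |E| vectors are spread over q sections. The factor on the left is
      -- the number of isotropic m, obtained as `polarCount` of the zero vector.
      cauchySchwarz-sections : ((+ q * (p * p) + p) - + q * p) * (∣E∣ * ∣E∣) ≤
        + q * (∣E∣ * (∣E∣ * (p * p)) + (- (q-1 * p) * isotropicPairs + q-1 * (p * p) * equalPairs))
      cauchySchwarz-sections = begin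
        ((+ q * (p * p) + p) - + q * p) * (∣E∣ * ∣E∣)
          ≡⟨ cong (_* (∣E∣ * ∣E∣)) (trans (sym polarCount-≡0) (∑-cong (vectors n) (λ m → trans
               (cong (δ (Q m ≟ 𝟘) *_) (δ-yes (_ ≟ 𝟘) (form-zeroʳ signs m))) (*-identityʳ _)))) ⟩
        ∑ⱽ n (λ m → δ (Q m ≟ 𝟘)) * (∣E∣ * ∣E∣)
          ≡⟨ ∑-*ʳ (vectors n) _ (∣E∣ * ∣E∣) ⟨
        ∑ⱽ n (λ m → δ (Q m ≟ 𝟘) * (∣E∣ * ∣E∣))
          ≤⟨ ∑-mono (vectors n) (λ m → pointwise m (Q m ≟ 𝟘)) ⟩
        ∑ⱽ n (λ m → + q * (δ (Q m ≟ 𝟘) * ∑ᴷ (λ c → section m c * section m c)))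
          ≡⟨ trans (∑-*ˡ (vectors n) (+ q) _) (cong (+ q *_) (trans ∑-isotropic-section² ∑∑-polarCount)) ⟩
        + q * (∣E∣ * (∣E∣ * (p * p)) + (- (q-1 * p) * isotropicPairs + q-1 * (p * p) * equalPairs)) ∎
        where
        open ≤-Reasoning
        cs : ∀ m → ∣E∣ * ∣E∣ ≤ + q * ∑ᴷ (λ c → section m c * section m c)
        cs m = subst₂ (λ s l → s * s ≤ + l * ∑ᴷ (λ c → section m c * section m c))
                      (∑-section m) length-elements (cauchySchwarz elements (section m))
        pointwise : ∀ m (isotropic? : Dec (Q m ≡ 𝟘)) → δ isotropic? * (∣E∣ * ∣E∣) ≤
                    + q * (δ isotropic? * ∑ᴷ (λ c → section m c * section m c))
        pointwise m (yes _) = subst₂ _≤_ (sym (*-identityˡ _)) (cong (+ q *_) (sym (*-identityˡ _))) (cs m)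
        pointwise m (no  _) = ≤-reflexive (sym (*-zeroʳ (+ q)))

      -- The leading terms q p²|E|² on the two sides of `cauchySchwarz-sections` cancel, and
      -- everything left is divisible by (q-1)p, which is positive because q - 1 = 2 + 4k. The
      -- negative coefficient of `isotropicPairs` turns the lower bound into an upper one.
      isotropicPairs-bound : + q * isotropicPairs ≤ ∣E∣ * ∣E∣ + + q * (p * equalPairs)
      isotropicPairs-bound = 0≤i-j⇒j≤i (*-cancelˡ-≤-pos 0ℤ _ (q-1 * p) {{q-1*p-positive}}
        (subst₂ _≤_ (sym (*-zeroʳ (q-1 * p))) (alg (+ q) p ∣E∣ isotropicPairs equalPairs)
          (i≤j⇒0≤j-i cauchySchwarz-sections)))
        where
        alg : ∀ q p e ν D →
          q * (e * (e * (p * p)) + (- ((q - 1ℤ) * p) * ν + (q - 1ℤ) * (p * p) * D)) -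
            ((q * (p * p) + p) - q * p) * (e * e) ≡
          ((q - 1ℤ) * p) * ((e * e + q * (p * D)) - q * ν)
        alg = solve-∀
        q-1*p-positive : Positive (q-1 * p)
        q-1*p-positive = subst Positive (trans (pos-* (2 ℕ.+ k ℕ.* 4) (q ℕ.^ (1 ℕ.+ j ℕ.* 2)))
                                         (cong (λ m → (+ m - 1ℤ) * p) (sym q≡3+4k)))
          (positive⁻ (ℕ.m*n≢0 (2 ℕ.+ k ℕ.* 4) (q ℕ.^ (1 ℕ.+ j ℕ.* 2))
                        {{_}} {{ℕ.m^n≢0 q (1 ℕ.+ j ℕ.* 2)}}))
          where
          positive⁻ : ∀ {m} → ℕ.NonZero m → Positive (+ m)
          positive⁻ {suc m} _ = _

    -- Points and spheres of square radius as elements of the quadratic space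

    norm-⊟ : ∀ {d} (x c : Vec K d) → norm (x ⊟ c) ≡ Incidences.sqDist F d x c
    norm-⊟ []       []       = refl
    norm-⊟ (x ∷ xs) (c ∷ cs) = cong₂ _⊕_
      (trans (cong₂ (λ u v → u ⊗ (𝟙 ⊗ v)) x⊟c x⊟c) (cong ((x ⊝ c) ⊗_) (K.*-identityˡ (x ⊝ c))))
      (norm-⊟ xs cs)
      where
      x⊟c = cong (x ⊕_) (K-Properties.-1*x≈-x c)

    Q-⊟ : ∀ x t c → Q ((𝟘 ∷ x) ⊟ (t ∷ c)) ≡ Incidences.sqDist F d x c ⊝ t ⊗ t
    Q-⊟ x t c = begin
      (𝟘 ⊕ ⊖ 𝟙 ⊗ t) ⊗ (⊖ 𝟙 ⊗ (𝟘 ⊕ ⊖ 𝟙 ⊗ t)) ⊕ norm (x ⊟ c)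
        -- Here -1 is an opaque e; the resulting e³ is reduced to -1 in the next step.
        ≡⟨ solveᴷ 3 (λ t e N → (con 0 :+ e :* t) :* (e :* (con 0 :+ e :* t)) :+ N :=
                               N :+ e :* (e :* (e :* (t :* t)))) refl t (⊖ 𝟙) (norm (x ⊟ c)) ⟩
      norm (x ⊟ c) ⊕ ⊖ 𝟙 ⊗ (⊖ 𝟙 ⊗ (⊖ 𝟙 ⊗ (t ⊗ t)))
        ≡⟨ cong₂ _⊕_ (norm-⊟ x c) (trans (K-Properties.-1*x≈-x _) (cong ⊖_
             (trans (K-Properties.-1*x≈-x _) (trans (cong ⊖_ (K-Properties.-1*x≈-x (t ⊗ t)))
                    (K-Properties.-‿involutive (t ⊗ t)))))) ⟩
      Incidences.sqDist F d x c ⊝ t ⊗ t ∎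
      where open ≡-Reasoning

    open Incidences F d

    infix 4 _≟ˢ_
    _≟ˢ_ : DecidableEquality Sphere
    _≟ˢ_ = ×.≡-dec _≟ⱽ_ _≟_

    -- Each sphere in `T` carries a chosen square root t of its radius, needed for the lift.
    -- Distinctness is required of the underlying spheres, so that two roots of one radius cannot
    -- produce two entries.
    module _ (P : List Point) (P! : Unique P)
             (T : List (∃[ s ] IsSquare (radius s))) (T! : Unique (map proj₁ T)) where

      liftPoint : Point → Vec K n
      liftPoint x = 𝟘 ∷ x

      liftSphere : ∃[ s ] IsSquare (radius s) → Vec K n
      liftSphere ((c , _) , t , _) = t ∷ c

      E : List (Vec K n)
      E = map liftPoint P ++ map liftSphere T

      -- Incidences embed into the points-by-spheres block of E × E; the remaining blocks only add
      -- nonnegative terms.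
      I≤isotropicPairs : + I P (map proj₁ T) ≤ isotropicPairs E
      I≤isotropicPairs = begin
        + I P (map proj₁ T)
          ≡⟨ ∑-δ≡length-filter (uncurry _∈ˢ?_) (cartesianProduct P (map proj₁ T)) ⟩
        ∑ (cartesianProduct P (map proj₁ T)) (λ xs → δ (uncurry _∈ˢ?_ xs))
          ≡⟨ trans (∑-cartesianProductWith _,_ P (map proj₁ T) _) (∑-cong P (λ x → ∑-map proj₁ T _)) ⟩
        ∑[ x ← P ] ∑[ τ ← T ] δ (x ∈ˢ? proj₁ τ)
          ≤⟨ ∑-mono P (λ x → ∑-mono T (λ τ → δ-mono (x ∈ˢ? proj₁ τ) (_ ≟ 𝟘) (incident⇒isotropic x τ))) ⟩
        ∑[ x ← P ] ∑[ τ ← T ] δ (Q (liftPoint x ⊟ liftSphere τ) ≟ 𝟘)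
          ≡⟨ trans (∑-map liftPoint P _) (∑-cong P (λ x → ∑-map liftSphere T _)) ⟨
        ∑[ x ← map liftPoint P ] ∑[ y ← map liftSphere T ] δ (Q (x ⊟ y) ≟ 𝟘)
          ≤⟨ ∑-mono (map liftPoint P) (λ x →
               ∑-++-≥ʳ (map liftPoint P) (map liftSphere T) (λ y → δ-nonNeg (Q (x ⊟ y) ≟ 𝟘))) ⟩
        ∑[ x ← map liftPoint P ] ∑[ y ← E ] δ (Q (x ⊟ y) ≟ 𝟘)
          ≤⟨ ∑-++-≥ˡ (map liftPoint P) (map liftSphere T) (λ x →
               ∑-nonNeg E (λ y → δ-nonNeg (Q (x ⊟ y) ≟ 𝟘))) ⟩
        isotropicPairs E ∎
        where
        open ≤-Reasoning
        incident⇒isotropic : ∀ x τ → x ∈ˢ proj₁ τ → Q (liftPoint x ⊟ liftSphere τ) ≡ 𝟘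
        incident⇒isotropic x ((c , r) , t , refl) x∈s =
          trans (Q-⊟ x t c) (K-Properties.x≈y⇒x∙y⁻¹≈ε x∈s)

      -- The 2 allows one match among the lifted points and one among the lifted spheres. Both can
      -- occur: a sphere with t = 0 centred at a point of `P` has the same lift as that point.
      equalPairs-bound : equalPairs E ≤ + length E * + 2
      equalPairs-bound = subst (equalPairs E ≤_) (∑-const E (+ 2)) (∑-mono E row)
        where
        open ≤-Reasoning
        points : ∀ x → ∑[ y ← map liftPoint P ] δ (x ≟ⱽ y) ≤ 1ℤ
        points x = begin
          ∑[ y ← map liftPoint P ] δ (x ≟ⱽ y)
            ≡⟨ ∑-cong (map liftPoint P) (λ y → δ-cong (x ≟ⱽ y) (y ≟ⱽ x) sym sym) ⟩
          ∑[ y ← map liftPoint P ] δ (y ≟ⱽ x)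
            ≤⟨ ∑-δ-≤1 _≟ⱽ_ (Unique.map⁺ ∷-injectiveʳ P!) x ⟩
          1ℤ ∎
        -- Recovers a sphere from its lift, so equal lifts come from equal spheres whichever roots
        -- were chosen.
        sphere : Vec K n → Sphere
        sphere (t ∷ c) = c , t ⊗ t
        spheres : ∀ x → ∑[ y ← map liftSphere T ] δ (x ≟ⱽ y) ≤ 1ℤ
        spheres x = begin
          ∑[ y ← map liftSphere T ] δ (x ≟ⱽ y)
            ≡⟨ ∑-map liftSphere T _ ⟩
          ∑[ τ ← T ] δ (x ≟ⱽ liftSphere τ)
            ≤⟨ ∑-mono T (λ τ → δ-mono (x ≟ⱽ liftSphere τ) (proj₁ τ ≟ˢ sphere x) (same τ)) ⟩
          ∑[ τ ← T ] δ (proj₁ τ ≟ˢ sphere x)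
            ≡⟨ ∑-map proj₁ T _ ⟨
          ∑[ s ← map proj₁ T ] δ (s ≟ˢ sphere x)
            ≤⟨ ∑-δ-≤1 _≟ˢ_ T! (sphere x) ⟩
          1ℤ ∎
          where
          same : ∀ τ → x ≡ liftSphere τ → proj₁ τ ≡ sphere x
          same (_ , t , refl) refl = refl
        row : ∀ x → ∑[ y ← E ] δ (x ≟ⱽ y) ≤ + 2
        row x = begin
          ∑[ y ← E ] δ (x ≟ⱽ y)  ≡⟨ ∑-++ (map liftPoint P) _ _ ⟩
          (∑[ y ← map liftPoint P ] δ (x ≟ⱽ y)) + (∑[ y ← map liftSphere T ] δ (x ≟ⱽ y))
                                 ≤⟨ +-mono-≤ (points x) (spheres x) ⟩
          + 2                    ∎

      -- The 4 arises twice from |E| ≤ 2N: |E|² ≤ 4N², and `equalPairs` is at most 2|E| ≤ 4N.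
      incidence-bound : ∀ {N} → length P ℕ.≤ N → length (map proj₁ T) ℕ.≤ N →
        + q * + I P (map proj₁ T) ≤ + 4 * (+ N * + N + + q * (p * + N))
      incidence-bound {N} ∣P∣≤N ∣S∣≤N = begin
        + q * + I P (map proj₁ T)
          ≤⟨ *-monoˡ-≤-nonNeg (+ q) I≤isotropicPairs ⟩
        + q * isotropicPairs E
          ≤⟨ isotropicPairs-bound E ⟩
        + length E * + length E + + q * (p * equalPairs E)
          ≤⟨ +-mono-≤
               (≤-trans (*-monoˡ-≤-nonNeg (+ length E) ∣E∣≤2N)
                        (*-monoʳ-≤-nonNeg (+ 2 * + N) {{subst NonNegative (pos-* 2 N) _}} ∣E∣≤2N))
               (*-monoˡ-≤-nonNeg (+ q) (*-monoˡ-≤-nonNeg p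
                 (≤-trans equalPairs-bound (*-monoʳ-≤-nonNeg (+ 2) ∣E∣≤2N)))) ⟩
        + 2 * + N * (+ 2 * + N) + + q * (p * (+ 2 * + N * + 2))
          ≡⟨ alg (+ q) p (+ N) ⟩
        + 4 * (+ N * + N + + q * (p * + N)) ∎
        where
        open ≤-Reasoning
        alg : ∀ q p N → + 2 * N * (+ 2 * N) + q * (p * (+ 2 * N * + 2)) ≡ + 4 * (N * N + q * (p * N))
        alg = solve-∀
        length-E : length E ≡ length P ℕ.+ length (map proj₁ T)
        length-E = trans (length-++ (map liftPoint P)) (cong₂ ℕ._+_ (length-map liftPoint P)
          (trans (length-map liftSphere T) (sym (length-map proj₁ T))))
        ∣E∣≤2N : + length E ≤ + 2 * + N
        ∣E∣≤2N = subst₂ _≤_ (cong +_ (sym length-E))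
          (trans (cong (λ m → + (N ℕ.+ m)) (sym (ℕ.+-identityʳ N))) (pos-* 2 N))
          (+≤+ (ℕ.+-mono-≤ ∣P∣≤N ∣S∣≤N))

-- From the integer inequality to the rational one.

module Rationals where
  open import Data.Integer.Base as ℤ using (+_; 1ℤ; _+_; _*_; _≤_)
  open import Data.Nat.Base using (suc)
  open import Data.Integer.Properties using (*-comm)
  open import Data.Integer.Tactic.RingSolver using (solve-∀)
  import Data.Nat.Properties as ℕ
  open import Data.Rational.Base as ℚ using (_/_; toℚᵘ)
  open import Data.Rational.Properties using (toℚᵘ-fromℚᵘ; toℚᵘ-cancel-≤; toℚᵘ-homo-+; toℚᵘ-homo-*)
  open import Data.Rational.Unnormalised.Base as ℚᵘ using (mkℚᵘ; *≤*)
  import Data.Rational.Unnormalised.Properties as ℚᵘ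
  open import Relation.Binary.PropositionalEquality

  -- Carried out in unnormalised rationals, where nothing is reduced to lowest terms: the right-hand
  -- side has denominator q, and the inequality is the hypothesis after cross-multiplication.
  clear-denominator : ∀ q .{{_ : NonZero q}} a b c e → + q * a ≤ e * (b + + q * c) →
                      a / 1 ℚ.≤ (e / 1) ℚ.* (b / q ℚ.+ c / 1)
  clear-denominator (suc m) a b c e h = toℚᵘ-cancel-≤ (begin
    toℚᵘ (a / 1)
      ≃⟨ toℚᵘ-fromℚᵘ (mkℚᵘ a 0) ⟩
    mkℚᵘ a 0
      ≤⟨ *≤* (subst₂ _≤_ left right h) ⟩
    mkℚᵘ e 0 ℚᵘ.* (mkℚᵘ b m ℚᵘ.+ mkℚᵘ c 0)
      ≃⟨ ℚᵘ.*-cong (toℚᵘ-fromℚᵘ (mkℚᵘ e 0))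
                   (ℚᵘ.+-cong (toℚᵘ-fromℚᵘ (mkℚᵘ b m)) (toℚᵘ-fromℚᵘ (mkℚᵘ c 0))) ⟨
    toℚᵘ (e / 1) ℚᵘ.* (toℚᵘ (b / suc m) ℚᵘ.+ toℚᵘ (c / 1))
      ≃⟨ ℚᵘ.*-congˡ {toℚᵘ (e / 1)} (toℚᵘ-homo-+ (b / suc m) (c / 1)) ⟨
    toℚᵘ (e / 1) ℚᵘ.* toℚᵘ (b / suc m ℚ.+ c / 1)
      ≃⟨ toℚᵘ-homo-* (e / 1) (b / suc m ℚ.+ c / 1) ⟨
    toℚᵘ ((e / 1) ℚ.* (b / suc m ℚ.+ c / 1)) ∎)
    where
    open ℚᵘ.≤-Reasoning
    q = + suc m
    den : ℚᵘ.ℚᵘ.denominator (mkℚᵘ e 0 ℚᵘ.* (mkℚᵘ b m ℚᵘ.+ mkℚᵘ c 0)) ≡ q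
    den = cong +_ (cong suc (trans (ℕ.+-identityʳ _) (ℕ.*-identityʳ m)))
    left : q * a ≡ a * ℚᵘ.ℚᵘ.denominator (mkℚᵘ e 0 ℚᵘ.* (mkℚᵘ b m ℚᵘ.+ mkℚᵘ c 0))
    left = trans (*-comm q a) (cong (a *_) (sym den))
    alg : ∀ e b q c → e * (b + q * c) ≡ e * (b * 1ℤ + c * q) * 1ℤ
    alg = solve-∀
    right : e * (b + q * c) ≡ e * (b * 1ℤ + c * q) * 1ℤ
    right = alg e b q c

-- The integer inequality in terms of the residues of q and d modulo 4.

module IntegralBound where

  open FieldSums using (module Elliptic)
  open import Data.Integer.Base using (+_; _+_; _*_; _≤_)
  open import Data.Integer.Properties using (pos-*)
  open import Data.List.Base using (List; []; _∷_; length; map)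
  open import Data.List.Relation.Unary.All using (All; []; _∷_)
  open import Data.List.Relation.Unary.Unique.Propositional using (Unique)
  open import Data.Nat.Base as ℕ using (ℕ; _∸_; _^_; _%_)
  open import Data.Nat.DivMod using (m≡m%n+[m/n]*n; m*n/n≡m)
  import Data.Nat.Properties as ℕ
  open import Data.Product.Base using (_,_; proj₁; ∃-syntax)
  open import Relation.Binary.PropositionalEquality

  n≡3+4[n/4] : ∀ n → n % 4 ≡ 3 → n ≡ 3 ℕ.+ n ℕ./ 4 ℕ.* 4
  n≡3+4[n/4] n n%4≡3 = trans (m≡m%n+[m/n]*n n 4) (cong (ℕ._+ n ℕ./ 4 ℕ.* 4) n%4≡3)

  2+4j≡[1+2j]*2 : ∀ j → 2 ℕ.+ j ℕ.* 4 ≡ (1 ℕ.+ j ℕ.* 2) ℕ.* 2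
  2+4j≡[1+2j]*2 j = cong (2 ℕ.+_) (sym (ℕ.*-assoc j 2 2))

  -- Turns the mere squareness of the radii into the list of spheres with chosen roots that the lift
  -- requires.
  attachWitnesses : ∀ {A : Set} {R : A → Set} {xs} → All R xs → ∃[ ys ] map (proj₁ {B = R}) ys ≡ xs
  attachWitnesses []       = [] , refl
  attachWitnesses (r ∷ rs) with attachWitnesses rs
  ... | ys , refl = (_ , r) ∷ ys , refl

  -- The shape of d is passed as an equation so that matching on `refl` replaces d by 3 + 4j; then d
  -- ∸ 1 computes to 2 + 4j, and its half is the exponent 1 + 2j of `p`.
  incidence-bound : ∀ {q d} j → d ≡ 3 ℕ.+ j ℕ.* 4 → q % 4 ≡ 3 → (F : FiniteField q) →
    let open FiniteField F using (IsSquare)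
        open Incidences F d
    in
    (P : List Point) → Unique P → (S : List Sphere) → Unique S →
    All (λ s → IsSquare (radius s)) S →
    (N : ℕ) → length P ℕ.≤ N → length S ℕ.≤ N →
    + q * + I P S ≤ + 4 * (+ (N ^ 2) + + q * + (q ^ ((d ∸ 1) ℕ./ 2) ℕ.* N))
  incidence-bound {q} j refl q%4≡3 F P P! S S! squares N ∣P∣≤N ∣S∣≤N with attachWitnesses squares
  ... | T , refl = subst₂ (λ a b → + q * + I P (map proj₁ T) ≤ + 4 * (a + + q * b))
    (trans (sym (pos-* N N)) (cong (λ m → + (N ℕ.* m)) (sym (ℕ.*-identityʳ N))))
    (trans (sym (pos-* (q ^ (1 ℕ.+ j ℕ.* 2)) N)) (cong (λ e → + (q ^ e ℕ.* N)) exponent))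
    (Elliptic.incidence-bound F (q ℕ./ 4) (n≡3+4[n/4] q q%4≡3) j P P! T S! ∣P∣≤N ∣S∣≤N)
    where
    open Incidences F (3 ℕ.+ j ℕ.* 4)
    exponent : 1 ℕ.+ j ℕ.* 2 ≡ (2 ℕ.+ j ℕ.* 4) ℕ./ 2
    exponent = sym (trans (cong (ℕ._/ 2) (2+4j≡[1+2j]*2 j)) (m*n/n≡m (1 ℕ.+ j ℕ.* 2) 2))

open import Data.Integer.Base using (+_)
open import Data.List.Base using (List; length)
open import Data.List.Relation.Unary.All using (All)
open import Data.List.Relation.Unary.Unique.Propositional using (Unique)
open import Data.Product.Base using (_×_; _,_; ∃-syntax)
open import Data.Rational.Base using (ℚ; 0ℚ; _/_; _+_; _*_; _≤_; _<_)
open import Data.Rational.Properties using (_<?_)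
open import Relation.Nullary.Decidable using (from-yes)

theorem1p4 :
    ∃[ C ] (0ℚ < C ×
      (∀ (q d : ℕ) .{{_ : NonZero q}} →
        IsOddPrimePower q → q % 4 ≡ 3 → d % 4 ≡ 3 →
        (F : FiniteField q) →
        let open FiniteField F using (IsSquare)
            open Incidences F d
        in
        (P : List Point) → Unique P →
        (S : List Sphere) → Unique S →
        All (λ s → IsSquare (radius s)) S →
        (N : ℕ) → length P ℕ.≤ N → length S ℕ.≤ N →
        (+ I P S) / 1 ≤
          C * ((+ (N ^ 2)) / q + (+ (q ^ ((d ∸ 1) ℕ./ 2) ℕ.* N)) / 1)))
theorem1p4 = + 4 / 1 , from-yes (0ℚ <? + 4 / 1) ,
  λ q d _ q%4≡3 d%4≡3 F P P! S S! squares N ∣P∣≤N ∣S∣≤N →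
    Rationals.clear-denominator q (+ Incidences.I F d P S) (+ (N ^ 2)) (+ (q ^ ((d ∸ 1) ℕ./ 2) ℕ.* N)) (+ 4)
      (IntegralBound.incidence-bound (d ℕ./ 4) (IntegralBound.n≡3+4[n/4] d d%4≡3) q%4≡3 F
        P P! S S! squares N ∣P∣≤N ∣S∣≤N)
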